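{- For all integers $n\ge0$, $pl_2(5n+3)\equiv0\pmod5$ and $pl_2(5n+4)\equiv0\pmod5$.
   Context: $pl_2(n)$ denotes the number of $2$-component plane partitions of $n$ (plane partitions of $n$ all of whose entries are $\le 2$), with $pl_2(0)=1$; equivalently $\sum_{n\ge0}pl_2(n)q^n=\frac{1}{1-q}\prod_{n=2}^{\infty}(1-q^n)^{ -2}$. -}

module Defs where

open import Data.List.Base using (List; []; _∷_; length; map; filter; cartesianProductWith)
open import Data.List.Membership.Propositional using (_∈_)
open import Data.List.Membership.Propositional.Properties
  using (∈-cartesianProductWith⁺; ∈-cartesianProductWith⁻; ∈-filter⁺; ∈-filter⁻)
import Data.List.Properties as List
open import Data.List.Relation.Binary.Prefix.Heterogeneous using (Prefix)
open import Data.List.Relation.Binary.Prefix.Heterogeneous.Properties using (prefix?)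
open import Data.List.Relation.Unary.All as All using (All; []; _∷_; all?)
open import Data.List.Relation.Unary.AllPairs using ([]; _∷_)
open import Data.List.Relation.Unary.Any using (here; there)
open import Data.List.Relation.Unary.Linked using (Linked; linked?)
open import Data.List.Relation.Unary.Unique.Propositional using (Unique)
import Data.List.Relation.Unary.Unique.Propositional.Properties as Unique
open import Data.Nat.Base using (ℕ; zero; suc; _<_; _≤_; _≥_; z≤n; s≤s)
open import Data.Nat.ListAction using (sum)
open import Data.Nat.Properties using (_≟_; _≤?_; _<?_; _≥?_; ≤-refl; ≤-trans; +-mono-≤; m≤m+n; m≤n+m)
open import Data.Product.Base using (_×_; _,_; proj₁; proj₂)
open import Function.Base using (_∘_)
open import Function.Bundles using (_⇔_; mk⇔)
open import Level using (Level)
open import Relation.Binary.Core using (Rel)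
open import Relation.Binary.Definitions using () renaming (Decidable to Decidable₂)
open import Relation.Binary.PropositionalEquality using (_≡_; refl)
open import Relation.Nullary.Decidable using (_×-dec_)
open import Relation.Unary using (Decidable)

private
  variable
    a : Level
    A : Set a
    n : ℕ

-- A two-dimensional array, as the list of its rows.
Array : Set
Array = List (List ℕ)

size : Array → ℕ
size π = sum (map sum π)

IsRow : List ℕ → Set
IsRow r = 0 < length r × All (0 <_) r × Linked _≥_ r

-- Row s fits below row r: it is no longer than r, and columns weakly decrease.
_⊵_ : Rel (List ℕ) _
r ⊵ s = Prefix _≤_ s r

-- Only the nonzero entries are stored: every row is nonempty and has positive
-- entries, so each plane partition has exactly one representation.
IsPlanePartition : Array → Set
IsPlanePartition π = All IsRow π × Linked _⊵_ π

EntriesAtMost2 : Array → Set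
EntriesAtMost2 = All (All (_≤ 2))

IsPlanePartition₂ : ℕ → Array → Set
IsPlanePartition₂ n π = IsPlanePartition π × EntriesAtMost2 π × size π ≡ n

isRow? : Decidable IsRow
isRow? r = 0 <? length r ×-dec all? (0 <?_) r ×-dec linked? _≥?_ r

_⊵?_ : Decidable₂ _⊵_
r ⊵? s = prefix? _≤?_ s r

isPlanePartition? : Decidable IsPlanePartition
isPlanePartition? π = all? isRow? π ×-dec linked? _⊵?_ π

entriesAtMost2? : Decidable EntriesAtMost2
entriesAtMost2? = all? (all? (_≤? 2))

isPlanePartition₂? : ∀ n → Decidable (IsPlanePartition₂ n)
isPlanePartition₂? n π = isPlanePartition? π ×-dec entriesAtMost2? π ×-dec size π ≟ n

-- words xs k lists the words of length at most k over the alphabet xs.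
words : List A → ℕ → List (List A)
words xs zero    = [] ∷ []
words xs (suc k) = [] ∷ cartesianProductWith _∷_ xs (words xs k)

-- Nonzero entries at most 2 with total n leave room for at most n rows,
-- each of length at most n; see ∈-planePartitions₂.
candidates : ℕ → List Array
candidates n = words (words (1 ∷ 2 ∷ []) n) n

planePartitions₂ : ℕ → List Array
planePartitions₂ n = filter (isPlanePartition₂? n) (candidates n)

pl₂ : ℕ → ℕ
pl₂ n = length (planePartitions₂ n)

private
  words-complete : ∀ {xs : List A} k {w} → All (_∈ xs) w → length w ≤ k → w ∈ words xs k
  words-complete zero    []         z≤n       = here refl
  words-complete (suc k) []         z≤n       = here refl
  words-complete (suc k) (x∈ ∷ w∈) (s≤s len) =
    there (∈-cartesianProductWith⁺ _∷_ x∈ (words-complete k w∈ len))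

  words-unique : ∀ {xs : List A} → Unique xs → ∀ k → Unique (words xs k)
  words-unique         u zero    = [] ∷ []
  words-unique {xs = xs} u (suc k) =
    All.tabulate nonempty ∷ Unique.cartesianProductWith⁺ _∷_ List.∷-injective u (words-unique u k)
    where
    nonempty : ∀ {w} → w ∈ cartesianProductWith _∷_ xs (words xs k) → [] ≡ w → _
    nonempty w∈ refl with () ← proj₂ (proj₂ (proj₂ (proj₂ (∈-cartesianProductWith⁻ _∷_ xs (words xs k) w∈))))

  length≤sum : ∀ {ms} → All (0 <_) ms → length ms ≤ sum ms
  length≤sum []         = z≤n
  length≤sum (0<m ∷ ms) = +-mono-≤ 0<m (length≤sum ms)

  row-length≤sum : ∀ {r} → IsRow r → length r ≤ sum r
  row-length≤sum (_ , pos , _) = length≤sum pos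

  length≤size : ∀ {π} → All IsRow π → length π ≤ size π
  length≤size []       = z≤n
  length≤size (r ∷ rs) = +-mono-≤ (≤-trans (proj₁ r) (row-length≤sum r)) (length≤size rs)

  entry∈ : ∀ {m} → 0 < m → m ≤ 2 → m ∈ (1 ∷ 2 ∷ [])
  entry∈ {1} _ _ = here refl
  entry∈ {2} _ _ = there (here refl)
  entry∈ {suc (suc (suc _))} _ (s≤s (s≤s ()))

  rows∈ : ∀ {π} → All IsRow π → EntriesAtMost2 π → size π ≤ n →
          All (_∈ words (1 ∷ 2 ∷ []) n) π
  rows∈ [] [] _ = []
  rows∈ {π = r ∷ π} (row@(_ , pos , _) ∷ rows) (r≤2 ∷ π≤2) size≤ =
    words-complete _ (All.zipWith (λ (0<m , m≤2) → entry∈ 0<m m≤2) (pos , r≤2))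
      (≤-trans (row-length≤sum row) (≤-trans (m≤m+n (sum r) (size π)) size≤))
    ∷ rows∈ rows π≤2 (≤-trans (m≤n+m (size π) (sum r)) size≤)

∈-planePartitions₂ : ∀ n {π} → π ∈ planePartitions₂ n ⇔ IsPlanePartition₂ n π
∈-planePartitions₂ n {π} = mk⇔ (proj₂ ∘ ∈-filter⁻ (isPlanePartition₂? n) {xs = candidates n}) complete
  where
  complete : IsPlanePartition₂ n π → π ∈ planePartitions₂ n
  complete p@((rows , _) , π≤2 , refl) =
    ∈-filter⁺ (isPlanePartition₂? n) (words-complete n (rows∈ rows π≤2 ≤-refl) (length≤size rows)) p

planePartitions₂-unique : ∀ n → Unique (planePartitions₂ n)
planePartitions₂-unique n =
  Unique.filter⁺ (isPlanePartition₂? n) (words-unique (words-unique alphabet n) n)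
  where
  alphabet : Unique (1 ∷ 2 ∷ [])
  alphabet = ((λ ()) ∷ []) ∷ [] ∷ []

{-# OPTIONS --safe #-}
module Submission where

open import Defs
open import Data.Nat.Divisibility using (_∣_)
open import Data.Product.Base using (_×_)

-- Write (q)ₐ = (1 − q)⋯(1 − qᵃ) and G a = 1 / (q)ₐ. A plane partition with entries at
-- most 2 is a sequence of rows, and the generating function of those lying under the row
-- with b twos and c ones is G(b+c) G(b) − q G(b+c+1) G(b−1), because both sides satisfy
-- the same recursion in b and c. For b = n, c = 0 this is (1 − q)(1 − qⁿ⁺¹) G(n+1)², so
-- pl₂(n) is the coefficient of qⁿ in (1 − q) G(n+1)². Modulo 5, G(N)² is (q)_N³ divided
-- by ∏ (1 − q⁵ⁱ), and by Jacobi's identity (q)_N³ agrees up to q^N with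
-- Σ (−1)ᵏ (2k+1) q^(k(k+1)/2), whose nonzero terms have exponents 0 or 1 modulo 5.
-- Hence the coefficients of G(N)² at exponents 2, 3, 4 modulo 5 vanish, and those of
-- (1 − q) G(N)² at exponents 3, 4.

open import Algebra.Bundles using (CommutativeRing; RawRing)
import Algebra.Properties.Semiring.Exp as Exp
import Algebra.Properties.Semiring.Mult.TCOptimised as Mult
import Algebra.Solver.Ring
open import Algebra.Solver.Ring.AlmostCommutativeRing using (fromCommutativeRing; _-Raw-AlmostCommutative⟶_)
open import Data.Bool.Base using (if_then_else_)
open import Data.Empty using (⊥)
open import Data.List.Base using (List; []; _∷_; _++_; length; map; filter; replicate; concatMap)
open import Data.List.Membership.Propositional using (_∈_; find; lose)
open import Data.List.Membership.Propositional.Properties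
  using (∈-++⁺ˡ; ∈-++⁺ʳ; ∈-++⁻; ∈-map⁺; ∈-map⁻; ∈-filter⁺; ∈-filter⁻; ∈-concatMap⁺; ∈-concatMap⁻)
open import Data.List.Membership.Propositional.Properties.WithK using (unique∧set⇒bag)
import Data.List.Properties as List
open import Data.List.Relation.Binary.BagAndSetEquality using (∼bag⇒↭)
open import Data.List.Relation.Binary.Permutation.Propositional.Properties using (↭-length)
open import Data.List.Relation.Binary.Prefix.Heterogeneous using ([]; _∷_)
open import Data.List.Relation.Unary.All as All using (All; []; _∷_)
import Data.List.Relation.Unary.All.Properties as All
open import Data.List.Relation.Unary.AllPairs as AllPairs using ([]; _∷_)
import Data.List.Relation.Unary.AllPairs.Properties as AllPairs
open import Data.List.Relation.Unary.Any using (here; there)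
open import Data.List.Relation.Unary.Linked using (Linked; []; [-]; _∷_; tail)
open import Data.List.Relation.Unary.Unique.Propositional using (Unique)
import Data.List.Relation.Unary.Unique.Propositional.Properties as Unique
open import Data.Maybe.Base using (Maybe; just; nothing)
open import Data.Nat.Base as ℕ using (ℕ; zero; suc; _∸_; _≤_; _<_; _≥_; z≤n; s≤s)
open import Data.Nat.Divisibility using (_∣?_; _∣0; ∣-refl; ∣m∣n⇒∣m+n; ∣m+n∣m⇒∣n; >⇒∤; m%n≡0⇒n∣m)
open import Data.Nat.DivMod using (_%_; _/_; m≡m%n+[m/n]*n; %-distribˡ-+; %-distribˡ-*; m*n%n≡0; [m+kn]%n≡m%n)
open import Data.Nat.Induction using (<-rec)
open import Data.Nat.ListAction using (sum)
import Data.Nat.Properties as ℕ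
open import Data.Nat.Tactic.RingSolver using (solve-∀)
open import Data.Product.Base using (_,_; proj₁; proj₂; ∃; map₂; uncurry)
open import Data.Sum.Base using (_⊎_; inj₁; inj₂)
open import Function.Base using (_∘_)
open import Function.Bundles using (mk⇔; Equivalence)
open import Level using (0ℓ)
open import Relation.Binary.PropositionalEquality as ≡ using (_≡_; _≢_)
open import Relation.Nullary using (¬_; Dec; yes; no; does; contradiction)

-- The closed form counts pairs of partitions: the cells with entry at least 1 and those with entry
-- at least 2 form two shapes, with rows of length at most b + c and at most b. G(b+c) G(b) counts
-- all pairs, so the subtracted product accounts for the pairs that are not nested.
--
-- Infinite products and limits never occur. Jacobi's identity comes from a finite triple product,
-- differentiated at z = 1; this gives an exact identity for (q)ₙ², and passing from there to (q)ₙ³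
-- only introduces multiples of qⁿ⁺¹, which are invisible at the exponents of interest. Likewise ∏
-- (1 - q⁵ⁱ)⁻¹ is never formed: in characteristic 5 it is G(N)⁵.
--
-- The identities are proved over an arbitrary commutative ring of characteristic 5, with q and G
-- constrained only by G(0) = 1 and G(a) = (1 - qᵃ⁺¹) G(a+1). They thus become polynomial identities
-- in a few symbols modulo linear relations.

-- Formal power series over a commutative ring

module PowerSeries {c ℓ} (K : CommutativeRing c ℓ) where
  open CommutativeRing K
  open import Relation.Binary.Reasoning.Setoid setoid
  open import Algebra.Properties.CommutativeSemigroup +-commutativeSemigroup using (interchange; x∙yz≈y∙xz)

  Series : Set c
  Series = ℕ → Carrier

  infix 4 _≐_ _≋_
  _≐_ : Series → Series → Set ℓ
  f ≐ g = ∀ n → f n ≈ g n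

  -- As a record, the relation lets unification recover `f` and `g`, which the bare function type
  -- `f ≐ g` does not.
  record _≋_ (f g : Series) : Set ℓ where
    constructor pointwise
    field coefficient : f ≐ g
  open _≋_ public

  constant : Carrier → Series
  constant x zero    = x
  constant x (suc _) = 0#

  infixl 7 _⋆_
  -- Cauchy product through f = f(0) + q (`f ∘ suc`), so that the ring laws are inductions on the
  -- exponent.
  _⋆_ : Series → Series → Series
  (f ⋆ g) zero    = f 0 * g 0
  (f ⋆ g) (suc n) = f 0 * g (suc n) + (f ∘ suc ⋆ g) n

  ⋆-cong : ∀ {f f′ g g′} → f ≐ f′ → g ≐ g′ → f ⋆ g ≐ f′ ⋆ g′
  ⋆-cong f≐ g≐ zero    = *-cong (f≐ 0) (g≐ 0)
  ⋆-cong f≐ g≐ (suc n) = +-cong (*-cong (f≐ 0) (g≐ (suc n))) (⋆-cong (f≐ ∘ suc) g≐ n)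

  -- The mirror image of the defining recursion; peeling the right factor is what lets the induction
  -- for commutativity close.
  ⋆-suc : ∀ f g n → (f ⋆ g) (suc n) ≈ g 0 * f (suc n) + (f ⋆ g ∘ suc) n
  ⋆-suc f g zero    = begin
    f 0 * g 1 + f 1 * g 0  ≈⟨ +-comm _ _ ⟩
    f 1 * g 0 + f 0 * g 1  ≈⟨ +-congʳ (*-comm _ _) ⟩
    g 0 * f 1 + f 0 * g 1  ∎
  ⋆-suc f g (suc n) = begin
    f 0 * g (suc (suc n)) + (f ∘ suc ⋆ g) (suc n)
      ≈⟨ +-congˡ (⋆-suc (f ∘ suc) g n) ⟩
    f 0 * g (suc (suc n)) + (g 0 * f (suc (suc n)) + (f ∘ suc ⋆ g ∘ suc) n)
      ≈⟨ x∙yz≈y∙xz _ _ _ ⟩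
    g 0 * f (suc (suc n)) + (f ⋆ g ∘ suc) (suc n)  ∎

  ⋆-comm : ∀ f g → f ⋆ g ≐ g ⋆ f
  ⋆-comm f g zero    = *-comm _ _
  ⋆-comm f g (suc n) = begin
    f 0 * g (suc n) + (f ∘ suc ⋆ g) n  ≈⟨ +-congˡ (⋆-comm (f ∘ suc) g n) ⟩
    f 0 * g (suc n) + (g ⋆ f ∘ suc) n  ≈⟨ ⋆-suc g f n ⟨
    (g ⋆ f) (suc n)                    ∎

  ⋆-distribʳ : ∀ h f g → (λ n → f n + g n) ⋆ h ≐ (λ n → (f ⋆ h) n + (g ⋆ h) n)
  ⋆-distribʳ h f g zero    = distribʳ _ _ _
  ⋆-distribʳ h f g (suc n) = begin
    (f 0 + g 0) * h (suc n) + ((λ m → f (suc m) + g (suc m)) ⋆ h) n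
      ≈⟨ +-cong (distribʳ _ _ _) (⋆-distribʳ h (f ∘ suc) (g ∘ suc) n) ⟩
    (f 0 * h (suc n) + g 0 * h (suc n)) + ((f ∘ suc ⋆ h) n + (g ∘ suc ⋆ h) n)
      ≈⟨ interchange _ _ _ _ ⟩
    (f ⋆ h) (suc n) + (g ⋆ h) (suc n)  ∎

  ⋆-scale : ∀ x f g → (λ n → x * f n) ⋆ g ≐ (λ n → x * (f ⋆ g) n)
  ⋆-scale x f g zero    = *-assoc _ _ _
  ⋆-scale x f g (suc n) = begin
    x * f 0 * g (suc n) + ((λ m → x * f (suc m)) ⋆ g) n
      ≈⟨ +-cong (*-assoc _ _ _) (⋆-scale x (f ∘ suc) g n) ⟩
    x * (f 0 * g (suc n)) + x * (f ∘ suc ⋆ g) n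
      ≈⟨ distribˡ _ _ _ ⟨
    x * (f ⋆ g) (suc n)  ∎

  ⋆-assoc : ∀ f g h → (f ⋆ g) ⋆ h ≐ f ⋆ (g ⋆ h)
  ⋆-assoc f g h zero    = *-assoc _ _ _
  ⋆-assoc f g h (suc n) = begin
    f 0 * g 0 * h (suc n) + ((λ m → f 0 * g (suc m) + (f ∘ suc ⋆ g) m) ⋆ h) n
      ≈⟨ +-congˡ (⋆-distribʳ h (λ m → f 0 * g (suc m)) (f ∘ suc ⋆ g) n) ⟩
    f 0 * g 0 * h (suc n) + (((λ m → f 0 * g (suc m)) ⋆ h) n + ((f ∘ suc ⋆ g) ⋆ h) n)
      ≈⟨ +-cong (*-assoc _ _ _) (+-cong (⋆-scale (f 0) (g ∘ suc) h n) (⋆-assoc (f ∘ suc) g h n)) ⟩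
    f 0 * (g 0 * h (suc n)) + (f 0 * (g ∘ suc ⋆ h) n + (f ∘ suc ⋆ (g ⋆ h)) n)
      ≈⟨ +-assoc _ _ _ ⟨
    f 0 * (g 0 * h (suc n)) + f 0 * (g ∘ suc ⋆ h) n + (f ∘ suc ⋆ (g ⋆ h)) n
      ≈⟨ +-congʳ (distribˡ _ _ _) ⟨
    (f ⋆ (g ⋆ h)) (suc n)  ∎

  constant-⋆ : ∀ x f → constant x ⋆ f ≐ (λ n → x * f n)
  constant-⋆ x f zero    = refl
  constant-⋆ x f (suc n) = trans (+-congˡ (zero-⋆ n)) (+-identityʳ _)
    where
    zero-⋆ : ∀ n → ((λ _ → 0#) ⋆ f) n ≈ 0#
    zero-⋆ zero    = zeroˡ _
    zero-⋆ (suc n) = trans (+-cong (zeroˡ _) (zero-⋆ n)) (+-identityˡ _)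

  seriesRing : CommutativeRing c ℓ
  seriesRing = record
    { Carrier = Series
    ; _≈_ = _≋_
    ; _+_ = λ f g n → f n + g n
    ; _*_ = _⋆_
    ; -_  = λ f n → - f n
    ; 0#  = λ _ → 0#
    ; 1#  = constant 1#
    ; isCommutativeRing = record
      { isRing = record
        { +-isAbelianGroup = record
          { isGroup = record
            { isMonoid = record
              { isSemigroup = record
                { isMagma = record
                  { isEquivalence = record
                    { refl  = pointwise λ _ → refl
                    ; sym   = λ e → pointwise λ n → sym (coefficient e n)
                    ; trans = λ e e′ → pointwise λ n → trans (coefficient e n) (coefficient e′ n) }
                  ; ∙-cong = λ e e′ → pointwise λ n → +-cong (coefficient e n) (coefficient e′ n) }
                ; assoc = λ f g h → pointwise λ n → +-assoc _ _ _ }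
              ; identity = (λ f → pointwise λ n → +-identityˡ _) , (λ f → pointwise λ n → +-identityʳ _) }
            ; inverse = (λ f → pointwise λ n → -‿inverseˡ _) , (λ f → pointwise λ n → -‿inverseʳ _)
            ; ⁻¹-cong = λ e → pointwise λ n → -‿cong (coefficient e n) }
          ; comm = λ f g → pointwise λ n → +-comm _ _ }
        ; *-cong = λ e e′ → pointwise (⋆-cong (coefficient e) (coefficient e′))
        ; *-assoc = λ f g h → pointwise (⋆-assoc f g h)
        ; *-identity = (λ f → pointwise (identityˡ f)) , λ f → pointwise λ n → trans (⋆-comm f _ n) (identityˡ f n)
        ; distrib = (λ h f g → pointwise λ n → trans (⋆-comm h _ n) (trans (⋆-distribʳ h f g n) (+-cong (⋆-comm f h n) (⋆-comm g h n))))
                  , λ h f g → pointwise (⋆-distribʳ h f g)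
        }
      ; *-comm = λ f g → pointwise (⋆-comm f g)
      }
    }
    where
    identityˡ : ∀ f → constant 1# ⋆ f ≐ f
    identityˡ f n = trans (constant-⋆ 1# f n) (*-identityˡ _)

  private module S = CommutativeRing seriesRing
  open import Algebra.Properties.Semiring.Exp S.semiring using (_^_)

  q : Series
  q zero    = 0#
  q (suc n) = constant 1# n

  q-zero : ∀ f → (q ⋆ f) 0 ≈ 0#
  q-zero f = zeroˡ _

  q-suc : ∀ f n → (q ⋆ f) (suc n) ≈ f n
  q-suc f n = trans (+-cong (zeroˡ _) (coefficient (S.*-identityˡ f) n)) (+-identityˡ _)

  q^-+ : ∀ m f n → (q ^ m ⋆ f) (m ℕ.+ n) ≈ f n
  q^-+ zero    f n = coefficient (S.*-identityˡ f) n
  q^-+ (suc m) f n = begin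
    (q ⋆ q ^ m ⋆ f) (suc m ℕ.+ n)    ≈⟨ coefficient (S.*-assoc q (q ^ m) f) (suc m ℕ.+ n) ⟩
    (q ⋆ (q ^ m ⋆ f)) (suc m ℕ.+ n)  ≈⟨ q-suc (q ^ m ⋆ f) (m ℕ.+ n) ⟩
    (q ^ m ⋆ f) (m ℕ.+ n)            ≈⟨ q^-+ m f n ⟩
    f n                              ∎

  q^-< : ∀ m f {n} → n ℕ.< m → (q ^ m ⋆ f) n ≈ 0#
  q^-< (suc m) f {zero}  _ = trans (coefficient (S.*-assoc q (q ^ m) f) 0) (q-zero (q ^ m ⋆ f))
  q^-< (suc m) f {suc n} (ℕ.s≤s n<m) = begin
    (q ⋆ q ^ m ⋆ f) (suc n)    ≈⟨ coefficient (S.*-assoc q (q ^ m) f) (suc n) ⟩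
    (q ⋆ (q ^ m ⋆ f)) (suc n)  ≈⟨ q-suc (q ^ m ⋆ f) n ⟩
    (q ^ m ⋆ f) n              ≈⟨ q^-< m f n<m ⟩
    0#                         ∎

  -- The series 1/(1 - qᵐ), given by its coefficients.
  geometric : ℕ → Series
  geometric m n = if does (m ∣? n) then 1# else 0#

  private
    geometric-∣ : ∀ {m n} → m ∣ n → geometric m n ≈ 1#
    geometric-∣ {m} {n} m∣n with m ∣? n
    ... | yes _   = refl
    ... | no  m∤n = contradiction m∣n m∤n

    geometric-∤ : ∀ {m n} → ¬ m ∣ n → geometric m n ≈ 0#
    geometric-∤ {m} {n} m∤n with m ∣? n
    ... | yes m∣n = contradiction m∣n m∤n
    ... | no  _   = refl

    geometric-+ : ∀ m n → geometric m (m ℕ.+ n) ≈ geometric m n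
    geometric-+ m n with m ∣? n
    ... | yes m∣n = geometric-∣ (∣m∣n⇒∣m+n ∣-refl m∣n)
    ... | no  m∤n = geometric-∤ (λ m∣m+n → m∤n (∣m+n∣m⇒∣n m∣m+n ∣-refl))

  geometric-unfold : ∀ m .{{_ : ℕ.NonZero m}} → geometric m ≋ S.1# S.+ q ^ m ⋆ geometric m
  geometric-unfold m = pointwise (unfold m)
    where
    unfold : ∀ m .{{_ : ℕ.NonZero m}} → geometric m ≐ S.1# S.+ q ^ m ⋆ geometric m
    unfold m n with n ℕ.<? m
    unfold m zero    | yes 0<m = trans (geometric-∣ (m ∣0)) (sym (trans (+-congˡ (q^-< m (geometric m) 0<m)) (+-identityʳ _)))
    unfold m (suc n) | yes n<m = trans (geometric-∤ (>⇒∤ n<m)) (sym (trans (+-congˡ (q^-< m (geometric m) n<m)) (+-identityʳ _)))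
    unfold m n       | no  n≮m = begin
      geometric m n                                   ≡⟨ ≡.cong (geometric m) n≡ ⟨
      geometric m (m ℕ.+ (n ∸ m))                     ≈⟨ geometric-+ m (n ∸ m) ⟩
      geometric m (n ∸ m)                             ≈⟨ q^-+ m (geometric m) (n ∸ m) ⟨
      (q ^ m ⋆ geometric m) (m ℕ.+ (n ∸ m))           ≡⟨ ≡.cong (q ^ m ⋆ geometric m) n≡ ⟩
      (q ^ m ⋆ geometric m) n                         ≈⟨ +-identityˡ _ ⟨
      0# + (q ^ m ⋆ geometric m) n                    ≈⟨ +-congʳ (constant≈0 n (ℕ.<-≤-trans (ℕ.>-nonZero⁻¹ m) m≤n)) ⟨
      constant 1# n + (q ^ m ⋆ geometric m) n         ∎
      where
      m≤n = ℕ.≮⇒≥ n≮m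
      n≡ = ℕ.m+[n∸m]≡n m≤n
      constant≈0 : ∀ {x} n → 0 ℕ.< n → constant x n ≈ 0#
      constant≈0 (suc n) _ = refl

-- The integers modulo 5

infix 4 _≡₅_
record _≡₅_ (m n : ℕ) : Set where
  constructor mod5
  field remainders : m % 5 ≡ n % 5
open _≡₅_ public

-- Carrier ℕ, with congruence modulo 5 as equality; −m is represented by 4m.
ℤ/5 : CommutativeRing 0ℓ 0ℓ
ℤ/5 = record
  { Carrier = ℕ
  ; _≈_ = _≡₅_
  ; _+_ = ℕ._+_
  ; _*_ = ℕ._*_
  ; -_  = 4 ℕ.*_
  ; 0#  = 0
  ; 1#  = 1
  ; isCommutativeRing = record
    { isRing = record
      { +-isAbelianGroup = record
        { isGroup = record
          { isMonoid = record
            { isSemigroup = record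
              { isMagma = record
                { isEquivalence = record
                  { refl  = mod5 ≡.refl
                  ; sym   = λ (mod5 e) → mod5 (≡.sym e)
                  ; trans = trans }
                ; ∙-cong = +-cong }
              ; assoc = λ l m n → ≡⇒≡₅ (ℕ.+-assoc l m n) }
            ; identity = (λ _ → mod5 ≡.refl) , (λ n → ≡⇒≡₅ (ℕ.+-identityʳ n)) }
          ; inverse = (λ n → trans (≡⇒≡₅ (ℕ.+-comm (4 ℕ.* n) n)) (inverseʳ n)) , inverseʳ
          ; ⁻¹-cong = *-cong {4} {4} (mod5 ≡.refl) }
        ; comm = λ m n → ≡⇒≡₅ (ℕ.+-comm m n) }
      ; *-cong = *-cong
      ; *-assoc = λ l m n → ≡⇒≡₅ (ℕ.*-assoc l m n)
      ; *-identity = (λ n → ≡⇒≡₅ (ℕ.*-identityˡ n)) , (λ n → ≡⇒≡₅ (ℕ.*-identityʳ n))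
      ; distrib = (λ l m n → ≡⇒≡₅ (ℕ.*-distribˡ-+ l m n)) , (λ l m n → ≡⇒≡₅ (ℕ.*-distribʳ-+ l m n))
      }
    ; *-comm = λ m n → ≡⇒≡₅ (ℕ.*-comm m n)
    }
  }
  where
  ≡⇒≡₅ : ∀ {m n} → m ≡ n → m ≡₅ n
  ≡⇒≡₅ m≡n = mod5 (≡.cong (_% 5) m≡n)
  trans : ∀ {l m n} → l ≡₅ m → m ≡₅ n → l ≡₅ n
  trans (mod5 l≡) (mod5 m≡) = mod5 (≡.trans l≡ m≡)
  +-cong : ∀ {m m′ n n′} → m ≡₅ m′ → n ≡₅ n′ → (m ℕ.+ n) ≡₅ (m′ ℕ.+ n′)
  +-cong {m} {m′} {n} {n′} (mod5 m≡) (mod5 n≡) = mod5 (≡.trans (%-distribˡ-+ m n 5)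
    (≡.trans (≡.cong₂ (λ a b → (a ℕ.+ b) % 5) m≡ n≡) (≡.sym (%-distribˡ-+ m′ n′ 5))))
  *-cong : ∀ {m m′ n n′} → m ≡₅ m′ → n ≡₅ n′ → (m ℕ.* n) ≡₅ (m′ ℕ.* n′)
  *-cong {m} {m′} {n} {n′} (mod5 m≡) (mod5 n≡) = mod5 (≡.trans (%-distribˡ-* m n 5)
    (≡.trans (≡.cong₂ (λ a b → (a ℕ.* b) % 5) m≡ n≡) (≡.sym (%-distribˡ-* m′ n′ 5))))
  inverseʳ : ∀ n → (5 ℕ.* n) ≡₅ 0
  inverseʳ n = trans (≡⇒≡₅ (ℕ.*-comm 5 n)) (mod5 (m*n%n≡0 n 5))

-- Polynomial identities in characteristic 5

HasCharacteristic5 : ∀ {c ℓ} → CommutativeRing c ℓ → Set ℓ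
HasCharacteristic5 R = 5 · 1# ≈ 0#
  where
  open CommutativeRing R
  open Mult semiring renaming (_×_ to _·_)

module Characteristic5 {c ℓ} (R : CommutativeRing c ℓ) (5×1≈0 : HasCharacteristic5 R) where

  open CommutativeRing R
  open Mult semiring renaming (_×_ to _·_)
  open import Relation.Binary.Reasoning.Setoid setoid
  open Exp semiring public
  open import Algebra.Properties.Ring ring

  private
    -- Reducing coefficients modulo 5 lets the solver prove identities that fail over the integers,
    -- such as (1 - y)⁵ = 1 - y⁵.
    coefficients : RawRing _ _
    coefficients = record
      { Carrier = ℕ
      ; _≈_ = _≡_
      ; _+_ = λ m n → (m ℕ.+ n) % 5
      ; _*_ = λ m n → (m ℕ.* n) % 5
      ; -_  = λ m → (4 ℕ.* m) % 5
      ; 0#  = 0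
      ; 1#  = 1
      }

    %5-× : ∀ n → (n % 5) · 1# ≈ n · 1#
    %5-× n = sym (begin
      n · 1#                                      ≡⟨ ≡.cong (_· 1#) (m≡m%n+[m/n]*n n 5) ⟩
      (n % 5 ℕ.+ n / 5 ℕ.* 5) · 1#                ≈⟨ ×-homo-+ 1# (n % 5) _ ⟩
      (n % 5) · 1# + (n / 5 ℕ.* 5) · 1#           ≈⟨ +-congˡ (×1-homo-* (n / 5) 5) ⟩
      (n % 5) · 1# + ((n / 5) · 1#) * (5 · 1#)    ≈⟨ +-congˡ (*-congˡ 5×1≈0) ⟩
      (n % 5) · 1# + ((n / 5) · 1#) * 0#          ≈⟨ +-congˡ (zeroʳ _) ⟩
      (n % 5) · 1# + 0#                           ≈⟨ +-identityʳ _ ⟩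
      (n % 5) · 1#                                ∎)

    4×≈- : ∀ n → (4 ℕ.* n) · 1# ≈ - (n · 1#)
    4×≈- n = +-inverseʳ-unique _ _ (begin
      n · 1# + (4 ℕ.* n) · 1#  ≈⟨ ×-homo-+ 1# n (4 ℕ.* n) ⟨
      (5 ℕ.* n) · 1#           ≈⟨ ×1-homo-* 5 n ⟩
      (5 · 1#) * (n · 1#)      ≈⟨ *-congʳ 5×1≈0 ⟩
      0# * (n · 1#)            ≈⟨ zeroˡ _ ⟩
      0#                       ∎)

    morphism : coefficients -Raw-AlmostCommutative⟶ fromCommutativeRing R
    morphism = record
      { ⟦_⟧    = _· 1#
      ; +-homo = λ m n → trans (%5-× (m ℕ.+ n)) (×-homo-+ 1# m n)
      ; *-homo = λ m n → trans (%5-× (m ℕ.* n)) (×1-homo-* m n)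
      ; -‿homo = λ n → trans (%5-× (4 ℕ.* n)) (4×≈- n)
      ; 0-homo = refl
      ; 1-homo = refl
      }

    _≟_ : ∀ m n → Maybe (m · 1# ≈ n · 1#)
    m ≟ n with m ℕ.≟ n
    ... | yes m≡n = just (reflexive (≡.cong (_· 1#) m≡n))
    ... | no  _   = nothing

  open Algebra.Solver.Ring coefficients (fromCommutativeRing R) morphism _≟_ public
    using (solve; _:=_; _:+_; _:*_; _:-_; :-_; _:^_; con)

  -- Substitutes v for u in an identity whose sides differ by k (u − v).
  substitute : ∀ {l r u v} k → u ≈ v → l - k * u ≈ r - k * v → l ≈ r
  substitute {l} {r} {u} {v} k u≈v l≈r = begin
    l                    ≈⟨ solve 2 (λ l m → l := (l :- m) :+ m) refl l (k * u) ⟩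
    (l - k * u) + k * u  ≈⟨ +-cong l≈r (*-congˡ u≈v) ⟩
    (r - k * v) + k * v  ≈⟨ solve 2 (λ l m → l := (l :- m) :+ m) refl r (k * v) ⟨
    r                    ∎

  geometric-inverse : ∀ {u y} g → u ≈ 1# + y * u → g ≈ (1# - y) * (g * u)
  geometric-inverse {u} {y} g u≈ = substitute (- g) u≈
    (solve 3 (λ g y u → let o = con 1 in
      g :- :- g :* u := (o :- y) :* (g :* u) :- :- g :* (o :+ y :* u)) refl g y u)

  Σ< : ℕ → (ℕ → Carrier) → Carrier
  Σ< zero    f = 0#
  Σ< (suc n) f = Σ< n f + f n

  odd : ℕ → Carrier
  odd zero    = 1#
  odd (suc k) = odd k + (1# + 1#)

  -- Recursions for the closed form

  module QSeries (q : Carrier) (G : ℕ → Carrier)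
    (G-zero : G 0 ≈ 1#) (G-suc : ∀ a → G a ≈ (1# - q ^ suc a) * G (suc a)) where

    -- Φ b c is the generating function of the plane partitions under the row with b twos
    -- and c ones; Ψ b c counts those whose first row has length b + c exactly.
    -- The factor G b * (1 − qᵇ) is G(b−1), read as 0 for b = 0.
    Φ : ℕ → ℕ → Carrier
    Φ b c = G (b ℕ.+ c) * G b - q * (G (suc (b ℕ.+ c)) * G b * (1# - q ^ b))

    Ψ : ℕ → ℕ → Carrier
    Ψ b c = q ^ (b ℕ.+ c) * (G (b ℕ.+ c) * G b)
          - q * (q ^ suc (b ℕ.+ c) * (G (suc (b ℕ.+ c)) * G b * (1# - q ^ b)))

    Φ-zero : Φ 0 0 ≈ 1#
    Φ-zero = begin
      G 0 * G 0 - q * (G 1 * G 0 * (1# - 1#))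
        ≈⟨ solve 3 (λ q g h → g :* g :- q :* (h :* g :* (con 1 :- con 1)) := g :* g) refl q (G 0) (G 1) ⟩
      G 0 * G 0  ≈⟨ *-cong G-zero G-zero ⟩
      1# * 1#    ≈⟨ *-identityˡ 1# ⟩
      1#         ∎

    Ψ-zero : ∀ c → q ^ c * Φ 0 c ≈ Ψ 0 c
    Ψ-zero c = solve 5 (λ q X A B g →
        X :* (A :* g :- q :* (B :* g :* (con 1 :- con 1)))
      := X :* (A :* g) :- q :* (q :* X :* (B :* g :* (con 1 :- con 1)))) refl
      q (q ^ c) (G c) (G (suc c)) (G 0)

    -- Mirrors the split of the first rows of length b + 1 + c: either the row with b + 1 twos, of
    -- weight (b + 1) + (b + 1 + c), or a row with at most b twos.
    Ψ-suc : ∀ b c → (q ^ suc b * q ^ (suc b ℕ.+ c)) * Φ (suc b) c + Ψ b (suc c) ≈ Ψ (suc b) c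
    Ψ-suc b c rewrite ℕ.+-suc b c =
      -- The cofactor is what multiplies `G b` in the difference of the two sides.
      substitute (X * A - q * (q * X * (B * (1# - Y)))) (G-suc b)
        (solve 7 (λ q Y X A B g h → let o = con 1; k = X :* A :- q :* (q :* X :* (B :* (o :- Y))) in
            ((q :* Y) :* X) :* (A :* g :- q :* (B :* g :* (o :- q :* Y)))
              :+ (X :* (A :* h) :- q :* (q :* X :* (B :* h :* (o :- Y)))) :- k :* h
          := X :* (A :* g) :- q :* (q :* X :* (B :* g :* (o :- q :* Y))) :- k :* ((o :- q :* Y) :* g))
          refl q Y X A B (G (suc b)) (G b))
      where
      Y = q ^ b
      X = q ^ suc (b ℕ.+ c)
      A = G (suc (b ℕ.+ c))
      B = G (suc (suc (b ℕ.+ c)))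

    -- Mirrors the split by the first row: it has the full length b + c + 1, or it is shorter
    -- (possibly absent) and fits under `(b , c)`.
    Φ-suc : ∀ b c → Φ b (suc c) ≈ Φ b c + Ψ b (suc c)
    Φ-suc b c rewrite ℕ.+-suc b c =
      substitute (- g) (G-suc (b ℕ.+ c)) (substitute (q * (g * (1# - Y))) (G-suc (suc (b ℕ.+ c)))
        (solve 7 (λ q Y X A₀ A₁ A₂ g → let o = con 1; k = q :* (g :* (o :- Y)) in
            A₁ :* g :- q :* (A₂ :* g :* (o :- Y)) :- (:- g) :* A₀ :- k :* A₁
          := A₀ :* g :- q :* (A₁ :* g :* (o :- Y))
               :+ (q :* X :* (A₁ :* g) :- q :* (q :* (q :* X) :* (A₂ :* g :* (o :- Y))))
               :- (:- g) :* ((o :- q :* X) :* A₁) :- k :* ((o :- q :* (q :* X)) :* A₂))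
          refl q Y (q ^ (b ℕ.+ c)) (G (b ℕ.+ c)) (G (suc (b ℕ.+ c))) (G (suc (suc (b ℕ.+ c)))) g))
      where
      Y = q ^ b
      g = G b

    -- The same split when there is no 1 to remove: a first row with at most b cells has at most b
    -- twos, hence fits under `(b , 0)`.
    Φ-suc-zero : ∀ b → Φ (suc b) 0 ≈ Φ b 0 + Ψ (suc b) 0
    Φ-suc-zero b rewrite ℕ.+-identityʳ b =
      -- `g₀` occurs squared, so its cofactor contains the sum g₀ + (1 - qY) g₁ from factoring a
      -- difference of squares.
      substitute (- (g₀ + (1# - q * Y) * g₁ - q * (g₁ * (1# - Y)))) (G-suc b)
        (substitute (q * (g₁ * (1# - q * Y))) (G-suc (suc b))
        (solve 5 (λ q Y g₀ g₁ g₂ →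
            let o = con 1
                k₁ = :- (g₀ :+ (o :- q :* Y) :* g₁ :- q :* (g₁ :* (o :- Y)))
                k₂ = q :* (g₁ :* (o :- q :* Y)) in
            g₁ :* g₁ :- q :* (g₂ :* g₁ :* (o :- q :* Y)) :- k₁ :* g₀ :- k₂ :* g₁
          := g₀ :* g₀ :- q :* (g₁ :* g₀ :* (o :- Y))
               :+ (q :* Y :* (g₁ :* g₁) :- q :* (q :* (q :* Y) :* (g₂ :* g₁ :* (o :- q :* Y))))
               :- k₁ :* ((o :- q :* Y) :* g₁) :- k₂ :* ((o :- q :* (q :* Y)) :* g₂))
          refl q Y g₀ g₁ (G (suc (suc b)))))
      where
      Y = q ^ b
      g₀ = G b
      g₁ = G (suc b)

    -- Once G(n) is replaced by (1 - qⁿ⁺¹) G(n+1), the remaining bracket (1 - qⁿ⁺¹) - q (1 - qⁿ)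
    -- collapses to 1 - q.
    Φ-square : ∀ n → Φ n 0 ≈ (1# - q) * ((1# - q ^ suc n) * (G (suc n) * G (suc n)))
    Φ-square n rewrite ℕ.+-identityʳ n =
      substitute (g₀ + (1# - q * Y) * g₁ - q * (g₁ * (1# - Y))) (G-suc n)
        (solve 4 (λ q Y g₀ g₁ →
            let o = con 1
                k = g₀ :+ (o :- q :* Y) :* g₁ :- q :* (g₁ :* (o :- Y)) in
            g₀ :* g₀ :- q :* (g₁ :* g₀ :* (o :- Y)) :- k :* g₀
          := (o :- q) :* ((o :- q :* Y) :* (g₁ :* g₁)) :- k :* ((o :- q :* Y) :* g₁))
          refl q Y g₀ g₁)
      where
      Y = q ^ n
      g₀ = G n
      g₁ = G (suc n)

    -- P a is (q)ₐ.
    P : ℕ → Carrier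
    P zero    = 1#
    P (suc a) = P a * (1# - q ^ suc a)

    P*G≈1 : ∀ a → P a * G a ≈ 1#
    P*G≈1 zero    = trans (*-identityˡ _) G-zero
    P*G≈1 (suc a) = begin
      (P a * (1# - q ^ suc a)) * G (suc a)  ≈⟨ *-assoc _ _ _ ⟩
      P a * ((1# - q ^ suc a) * G (suc a))  ≈⟨ *-congˡ (G-suc a) ⟨
      P a * G a                             ≈⟨ P*G≈1 a ⟩
      1#                                    ∎

    -- Frobenius, (1 - y)⁵ = 1 - y⁵: the fifth powers satisfy the recursion of ∏ (1 - q⁵ⁱ)⁻¹.
    G⁵-suc : ∀ a → G (suc a) ^ 5 ≈ G a ^ 5 + q ^ (suc a ℕ.* 5) * G (suc a) ^ 5
    G⁵-suc a = begin
      g ^ 5                                         ≈⟨ solve 2 (λ y g → g :^ 5 := ((con 1 :- y) :* g) :^ 5 :+ y :^ 5 :* g :^ 5) refl y g ⟩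
      ((1# - y) * g) ^ 5 + y ^ 5 * g ^ 5            ≈⟨ +-cong (^-congˡ 5 (sym (G-suc a))) (*-congʳ (^-assocʳ q (suc a) 5)) ⟩
      G a ^ 5 + q ^ (suc a ℕ.* 5) * g ^ 5           ∎
      where
      y = q ^ suc a
      g = G (suc a)

    G²≈P³G⁵ : ∀ n → G n * G n ≈ P n ^ 3 * G n ^ 5
    G²≈P³G⁵ n = begin
      G n * G n                    ≈⟨ solve 1 (λ g → g :* g := con 1 :^ 3 :* (g :* g)) refl (G n) ⟩
      1# ^ 3 * (G n * G n)         ≈⟨ *-congʳ (^-congˡ 3 (P*G≈1 n)) ⟨
      (P n * G n) ^ 3 * (G n * G n) ≈⟨ solve 2 (λ p g → (p :* g) :^ 3 :* (g :* g) := p :^ 3 :* g :^ 5) refl (P n) (G n) ⟩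
      P n ^ 3 * G n ^ 5            ∎

    -- A finite form of Jacobi's identity

    -- G̃ i is G(i−1), with 1/(q)₋₁ = 0; together with truncated subtraction this makes
    -- t n k vanish for k > n.
    G̃ : ℕ → Carrier
    G̃ zero    = 0#
    G̃ (suc i) = G i

    G̃-suc : ∀ i → G̃ i ≈ (1# - q ^ i) * G̃ (suc i)
    G̃-suc zero    = solve 1 (λ g → con 0 := (con 1 :- con 1) :* g) refl (G 0)
    G̃-suc (suc i) = G-suc i

    -- The factor q on the left avoids the exponent i - 1, so that one formula also covers i = 0,
    -- where both sides vanish.
    G̃-pred : ∀ i → q * G̃ (ℕ.pred i) ≈ (q - q ^ i) * ((1# - q ^ i) * G̃ (suc i))
    G̃-pred zero    = solve 2 (λ q g → q :* con 0 := (q :- con 1) :* ((con 1 :- con 1) :* g)) refl q (G 0)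
    G̃-pred (suc i) = begin
      q * G̃ i                            ≈⟨ *-congˡ (G̃-suc i) ⟩
      q * ((1# - q ^ i) * G i)           ≈⟨ *-congˡ (*-congˡ (G-suc i)) ⟩
      q * ((1# - q ^ i) * ((1# - q ^ suc i) * G (suc i)))
        ≈⟨ solve 3 (λ q y g → q :* ((con 1 :- y) :* g) := (q :- q :* y) :* g) refl q (q ^ i) _ ⟩
      (q - q ^ suc i) * ((1# - q ^ suc i) * G (suc i))  ∎

    -- (-1)ᵏ q^(k(k+1)/2), the numerator of the k-th triple product coefficient.
    θ : ℕ → Carrier
    θ zero    = 1#
    θ (suc k) = - (θ k * q ^ suc k)

    -- (q)₂ₙ₊₁ t n k is the coefficient of zᵏ in ∏_{i=0}^{n} (1 − z⁻¹ qⁱ) ∏_{i=1}^{n} (1 − z qⁱ).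
    -- Multiplying by (1 − z x)(1 − z⁻¹ x) with x = qⁿ⁺¹ gives the recursion t-suc; the
    -- coefficients change sign under k ↦ −1 − k, which gives t-zero.
    t : ℕ → ℕ → Carrier
    t n k = θ k * (G̃ (suc n ∸ k) * G (suc n ℕ.+ k))

    t-vanishes : ∀ {n k} → n ℕ.< k → t n k ≈ 0#
    t-vanishes {n} {k} n<k rewrite ℕ.m≤n⇒m∸n≡0 n<k =
      trans (*-congˡ (zeroˡ _)) (zeroʳ _)

    -- At x = qⁿ⁺¹ this is (q)₂ₙ₊₃ / (q)₂ₙ₊₁, the change of normalisation from `t n` to `t (suc n)`.
    D : Carrier → Carrier
    D x = (1# - x * x) * (1# - x * x * q)

    D-cong : ∀ {x y} → x ≈ y → D x ≈ D y
    D-cong e = *-cong (+-congˡ (-‿cong (*-cong e e))) (+-congˡ (-‿cong (*-congʳ (*-cong e e))))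

    -- The zᵏ-coefficient after multiplication by (1 - zx)(1 - z⁻¹x) = 1 + x² - xz - xz⁻¹, when `a`,
    -- `b`, `c` are the old coefficients at k - 1, k, k + 1.
    E : Carrier → Carrier → Carrier → Carrier → Carrier
    E x a b c = (1# + x * x) * b - x * c - x * a

    E-cong : ∀ {x y a b c} → x ≈ y → E x a b c ≈ E y a b c
    E-cong e = +-cong (+-cong (*-congʳ (+-congˡ (*-cong e e))) (-‿cong (*-congʳ e))) (-‿cong (*-congʳ e))

    -- The recursion `t-suc` with independent symbols: y = qⁿ⁻ᵏ, z = qᵏ, s = `θ k`, while the g and
    -- h are consecutive values of `G̃` and `G`.
    t-identity : ∀ y z s g₀ g₁ g₂ h₀ h₁ h₂ → let x = q * (y * z) in
      g₁ ≈ (1# - y) * g₂ → q * g₀ ≈ (q - y) * ((1# - y) * g₂) →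
      h₀ ≈ (1# - q * (q * (y * z * z))) * h₁ → h₁ ≈ (1# - q * (q * (q * (y * z * z)))) * h₂ →
      D x * (- (s * (q * z)) * (g₂ * h₂)) ≈
      E x (s * (g₂ * h₀)) (- (s * (q * z)) * (g₁ * h₁)) (- (- (s * (q * z)) * (q * (q * z))) * (g₀ * h₂))
    t-identity y z s g₀ g₁ g₂ h₀ h₁ h₂ g₁≈ g₀≈ h₀≈ h₁≈ =
      -- `h₀`, `h₁`, `g₁` and `q * g₀` are eliminated in this order; each cofactor is the
      -- coefficient of that symbol in left minus right side at its stage.
      substitute (x * (s * g₂)) h₀≈
      (substitute ((1# + x * x) * (s * (q * z)) * g₁ + x * (s * g₂) * (1# - w)) h₁≈
      (substitute ((1# + x * x) * (s * (q * z)) * ((1# - q * w) * h₂)) g₁≈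
      (substitute (x * (s * (q * z) * (q * z)) * h₂) g₀≈
      (solve 10 (λ q y z s g₀ g₁ g₂ h₀ h₁ h₂ →
        let o = con 1
            x = q :* (y :* z)
            w = q :* (q :* (y :* z :* z))
            k₁ = x :* (s :* g₂)
            k₂ = (o :+ x :* x) :* (s :* (q :* z)) :* g₁ :+ x :* (s :* g₂) :* (o :- w)
            k₃ = (o :+ x :* x) :* (s :* (q :* z)) :* ((o :- q :* w) :* h₂)
            k₄ = x :* (s :* (q :* z) :* (q :* z)) :* h₂
            θ₁ = :- (s :* (q :* z))
            θ₂ = :- (θ₁ :* (q :* (q :* z)))
        in
           (o :- x :* x) :* (o :- x :* x :* q) :* (θ₁ :* (g₂ :* h₂))
             :- k₁ :* h₀ :- k₂ :* h₁ :- k₃ :* g₁ :- k₄ :* (q :* g₀)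
        := (o :+ x :* x) :* (θ₁ :* (g₁ :* h₁)) :- x :* (θ₂ :* (g₀ :* h₂)) :- x :* (s :* (g₂ :* h₀))
             :- k₁ :* ((o :- w) :* h₁) :- k₂ :* ((o :- q :* w) :* h₂)
             :- k₃ :* ((o :- y) :* g₂) :- k₄ :* ((q :- y) :* ((o :- y) :* g₂)))
        refl q y z s g₀ g₁ g₂ h₀ h₁ h₂))))
      where
      x = q * (y * z)
      w = q * (q * (y * z * z))

    t-zero : ∀ n → let x = q ^ suc n in
      D x * t (suc n) 0 ≈ (1# + x + x * x) * t n 0 - x * t n 1
    t-zero n rewrite ℕ.+-identityʳ n | ℕ.+-comm n 1 =
      substitute (- ((1# + x + x * x) * g₁)) (G-suc (suc n))
      (substitute (- (x * q * h)) (G̃-suc n)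
      (substitute (- ((1# + x + x * x) * ((1# - q * x) * h)) - x * q * h * (1# - X)) (G-suc n)
      (solve 6 (λ q X g₀ g₁ g₂ h →
        let o = con 1
            x = q :* X
            k₁ = :- ((o :+ x :+ x :* x) :* g₁)
            k₂ = :- (x :* q :* h)
            k₃ = :- ((o :+ x :+ x :* x) :* ((o :- q :* x) :* h)) :- x :* q :* h :* (o :- X)
        in
           (o :- x :* x) :* (o :- x :* x :* q) :* (o :* (g₂ :* h)) :- k₁ :* g₂ :- k₂ :* g₀ :- k₃ :* g₁
        := (o :+ x :+ x :* x) :* (o :* (g₁ :* g₂)) :- x :* (:- (o :* (q :* o)) :* (g₀ :* h))
             :- k₁ :* ((o :- q :* x) :* h) :- k₂ :* ((o :- X) :* g₁) :- k₃ :* ((o :- x) :* g₂))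
        refl q X (G̃ n) g₁ (G (suc n)) h)))
      where
      X = q ^ n
      x = q * X
      g₁ = G n
      h = G (suc (suc n))

    private
      suc[m+n]∸n : ∀ m n → suc (m ℕ.+ n) ∸ n ≡ suc m
      suc[m+n]∸n m n = ℕ.m+n∸n≡m (suc m) n

      -- Writing n = i + k turns the truncated differences into `suc i`, `i` and `pred i`.
      t-suc-+ : ∀ i k → let n = i ℕ.+ k in
        D (q ^ suc n) * t (suc n) (suc k) ≈ E (q ^ suc n) (t n k) (t n (suc k)) (t n (suc (suc k)))
      t-suc-+ i k
        rewrite ≡.sym (ℕ.pred[m∸n]≡m∸[1+n] (i ℕ.+ k) k)
              | suc[m+n]∸n i k | ℕ.m+n∸n≡m i k
              | ℕ.+-suc (i ℕ.+ k) (suc k) | ℕ.+-suc (i ℕ.+ k) k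
        = begin
        D x * T₁       ≈⟨ *-congʳ (D-cong x≈) ⟩
        D x′ * T₁      ≈⟨ t-identity (q ^ i) (q ^ k) (θ k) _ _ _ _ _ _ (G̃-suc i) (G̃-pred i)
                            (G-suc′ 1) (G-suc′ 2) ⟩
        E x′ T₂ T₃ T₄  ≈⟨ E-cong x≈ ⟨
        E x T₂ T₃ T₄   ∎
        where
        n = i ℕ.+ k
        x = q ^ suc n
        x′ = q * (q ^ i * q ^ k)
        x≈ : x ≈ x′
        x≈ = *-congˡ (^-homo-* q i k)
        T₁ = θ (suc k) * (G̃ (suc i) * G (3 ℕ.+ (n ℕ.+ k)))
        T₂ = θ k * (G̃ (suc i) * G (1 ℕ.+ (n ℕ.+ k)))
        T₃ = θ (suc k) * (G̃ i * G (2 ℕ.+ (n ℕ.+ k)))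
        T₄ = θ (suc (suc k)) * (G̃ (ℕ.pred i) * G (3 ℕ.+ (n ℕ.+ k)))
        w≈ : q ^ (n ℕ.+ k) ≈ q ^ i * q ^ k * q ^ k
        w≈ = trans (^-homo-* q n k) (*-congʳ (^-homo-* q i k))
        q^ : ℕ → Carrier
        q^ zero    = q ^ i * q ^ k * q ^ k
        q^ (suc j) = q * q^ j
        q^≈ : ∀ j → q ^ (j ℕ.+ (n ℕ.+ k)) ≈ q^ j
        q^≈ zero    = w≈
        q^≈ (suc j) = *-congˡ (q^≈ j)
        G-suc′ : ∀ j → G (j ℕ.+ (n ℕ.+ k)) ≈ (1# - q^ (suc j)) * G (suc (j ℕ.+ (n ℕ.+ k)))
        G-suc′ j = trans (G-suc (j ℕ.+ (n ℕ.+ k))) (*-congʳ (+-congˡ (-‿cong (q^≈ (suc j)))))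

    t-suc : ∀ n k → let x = q ^ suc n in
      D x * t (suc n) (suc k) ≈ E x (t n k) (t n (suc k)) (t n (suc (suc k)))
    t-suc n k with k ℕ.≤? n
    ... | yes k≤n = ≡.subst
      (λ n → let x = q ^ suc n in D x * t (suc n) (suc k) ≈ E x (t n k) (t n (suc k)) (t n (suc (suc k))))
      (ℕ.m∸n+n≡m k≤n) (t-suc-+ (n ∸ k) k)
    ... | no  k≰n = begin
      D x * t (suc n) (suc k)  ≈⟨ *-congˡ (t-vanishes {suc n} (ℕ.s≤s n<k)) ⟩
      D x * 0#                 ≈⟨ solve 2 (λ d x → d :* con 0 := (con 1 :+ x :* x) :* con 0 :- x :* con 0 :- x :* con 0) refl (D x) x ⟩
      E x 0# 0# 0#
        ≈⟨ +-cong (+-cong (*-congˡ (t-vanishes {n} (ℕ.m<n⇒m<1+n n<k)))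
                          (-‿cong (*-congˡ (t-vanishes {n} (ℕ.m<n⇒m<1+n (ℕ.m<n⇒m<1+n n<k))))))
                  (-‿cong (*-congˡ (t-vanishes {n} n<k))) ⟨
      E x (t n k) (t n (suc k)) (t n (suc (suc k))) ∎
      where
      x = q ^ suc n
      n<k = ℕ.≰⇒> k≰n

    -- Up to the factor (q)₂ₙ₊₁, and for m > n, this is the derivative at z = 1 of the product
    -- described at `t`: pairing k with -1 - k, whose coefficients are opposite, gives the weight k
    -- - (-1 - k) = 2k + 1.
    jacobiSum : ℕ → ℕ → Carrier
    jacobiSum m n = Σ< m (λ k → odd k * t n k)

    -- The sum is over k ≤ m; the last summand is the boundary term of a summation by parts,
    -- which is 0 for m > n.
    jacobiSum-suc : ∀ m n → let x = q ^ suc n in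
      D x * jacobiSum (suc m) (suc n) ≈
      (1# - x) * (1# - x) * jacobiSum (suc m) n + x * (odd (suc m) * t n m - odd m * t n (suc m))
    jacobiSum-suc zero n = begin
      D x * (0# + 1# * t (suc n) 0)
        ≈⟨ solve 2 (λ d t → d :* (con 0 :+ con 1 :* t) := d :* t) refl (D x) (t (suc n) 0) ⟩
      D x * t (suc n) 0  ≈⟨ t-zero n ⟩
      (1# + x + x * x) * t n 0 - x * t n 1
        ≈⟨ solve 3 (λ x t₀ t₁ → let o = con 1 in
             (o :+ x :+ x :* x) :* t₀ :- x :* t₁ :=
             (o :- x) :* (o :- x) :* (con 0 :+ o :* t₀) :+ x :* ((o :+ (o :+ o)) :* t₀ :- o :* t₁)) refl x (t n 0) (t n 1) ⟩
      (1# - x) * (1# - x) * jacobiSum 1 n + x * (odd 1 * t n 0 - odd 0 * t n 1)  ∎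
      where x = q ^ suc n
    jacobiSum-suc (suc m) n = begin
      D x * (S′ + (d + 2#) * t′)
        ≈⟨ solve 4 (λ d s c t → d :* (s :+ c :* t) := d :* s :+ c :* (d :* t)) refl (D x) S′ (d + 2#) t′ ⟩
      D x * S′ + (d + 2#) * (D x * t′)
        ≈⟨ +-cong (jacobiSum-suc m n) (*-congˡ (t-suc n m)) ⟩
      ((1# - x) * (1# - x) * S + x * ((d + 2#) * t₀ - d * t₁)) + (d + 2#) * E x t₀ t₁ t₂
        ≈⟨ solve 6 (λ x c s t₀ t₁ t₂ → let o = con 1; c₁ = c :+ (o :+ o); c₂ = c₁ :+ (o :+ o) in
             ((o :- x) :* (o :- x) :* s :+ x :* (c₁ :* t₀ :- c :* t₁))
               :+ c₁ :* ((o :+ x :* x) :* t₁ :- x :* t₂ :- x :* t₀)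
          := (o :- x) :* (o :- x) :* (s :+ c₁ :* t₁) :+ x :* (c₂ :* t₁ :- c₁ :* t₂))
          refl x d S t₀ t₁ t₂ ⟩
      (1# - x) * (1# - x) * (S + (d + 2#) * t₁) + x * (((d + 2#) + 2#) * t₁ - (d + 2#) * t₂)  ∎
      where
      x = q ^ suc n
      2# = 1# + 1#
      d = odd m
      S = jacobiSum (suc m) n
      S′ = jacobiSum (suc m) (suc n)
      t′ = t (suc n) (suc m)
      t₀ = t n m
      t₁ = t n (suc m)
      t₂ = t n (suc (suc m))

    jacobiSum-zero : ∀ m → jacobiSum (suc m) 0 ≈ t 0 0
    jacobiSum-zero zero    = solve 1 (λ t → con 0 :+ con 1 :* t := t) refl (t 0 0)
    jacobiSum-zero (suc m) = begin
      jacobiSum (suc m) 0 + odd (suc m) * t 0 (suc m)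
        ≈⟨ +-cong (jacobiSum-zero m) (*-congˡ (t-vanishes {0} {suc m} (ℕ.s≤s ℕ.z≤n))) ⟩
      t 0 0 + odd (suc m) * 0#  ≈⟨ solve 2 (λ t c → t :+ c :* con 0 := t) refl (t 0 0) (odd (suc m)) ⟩
      t 0 0                     ∎

    -- Only the factor 1 - z⁻¹ vanishes at z = 1, so the derivative there is the product of the
    -- other factors, (q)ₙ². In the induction each step contributes (1 - x)²; the fixed m exceeds
    -- every n in play, which kills the boundary term.
    finiteJacobi : ∀ n m → n ℕ.< m → P (suc (n ℕ.+ n)) * jacobiSum (suc m) n ≈ P n * P n
    finiteJacobi zero m _ = begin
      P 1 * jacobiSum (suc m) 0  ≈⟨ *-congˡ (jacobiSum-zero m) ⟩
      P 1 * (1# * (G 0 * G 1))   ≈⟨ solve 3 (λ p g h → p :* (con 1 :* (g :* h)) := g :* (p :* h)) refl (P 1) (G 0) (G 1) ⟩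
      G 0 * (P 1 * G 1)          ≈⟨ *-cong G-zero (P*G≈1 1) ⟩
      1# * 1#                    ∎
    finiteJacobi (suc n) m 1+n<m rewrite ℕ.+-suc n n = begin
      P (suc (n ℕ.+ n)) * (1# - q * q ^ suc (n ℕ.+ n)) * (1# - q * (q * q ^ suc (n ℕ.+ n))) * jacobiSum (suc m) (suc n)
        ≈⟨ *-congʳ (*-cong (*-congˡ (+-congˡ (-‿cong q^≈))) (+-congˡ (-‿cong (*-congˡ q^≈)))) ⟩
      P (suc (n ℕ.+ n)) * (1# - x * x) * (1# - q * (x * x)) * jacobiSum (suc m) (suc n)
        ≈⟨ solve 4 (λ p q x s → let o = con 1 in
             p :* (o :- x :* x) :* (o :- q :* (x :* x)) :* s := p :* ((o :- x :* x) :* (o :- x :* x :* q) :* s))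
             refl (P (suc (n ℕ.+ n))) q x (jacobiSum (suc m) (suc n)) ⟩
      P (suc (n ℕ.+ n)) * (D x * jacobiSum (suc m) (suc n))
        ≈⟨ *-congˡ (jacobiSum-suc m n) ⟩
      P (suc (n ℕ.+ n)) * ((1# - x) * (1# - x) * S + x * (odd (suc m) * t n m - odd m * t n (suc m)))
        ≈⟨ *-congˡ (+-congˡ (*-congˡ (+-cong (*-congˡ (t-vanishes {n} n<m)) (-‿cong (*-congˡ (t-vanishes {n} (ℕ.m<n⇒m<1+n n<m))))))) ⟩
      P (suc (n ℕ.+ n)) * ((1# - x) * (1# - x) * S + x * (odd (suc m) * 0# - odd m * 0#))
        ≈⟨ solve 5 (λ p x s c d → let y = con 1 :- x in
             p :* (y :* y :* s :+ x :* (c :* con 0 :- d :* con 0)) := p :* s :* y :* y) refl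
             (P (suc (n ℕ.+ n))) x S (odd (suc m)) (odd m) ⟩
      P (suc (n ℕ.+ n)) * S * (1# - x) * (1# - x)
        ≈⟨ *-congʳ (*-congʳ (finiteJacobi n m n<m)) ⟩
      P n * P n * (1# - x) * (1# - x)
        ≈⟨ solve 2 (λ p y → p :* p :* y :* y := p :* y :* (p :* y)) refl (P n) (1# - x) ⟩
      P n * (1# - x) * (P n * (1# - x))  ∎
      where
      x = q ^ suc n
      S = jacobiSum (suc m) n
      n<m = ℕ.<-trans (ℕ.n<1+n n) 1+n<m
      q^≈ : q * (q * q ^ (n ℕ.+ n)) ≈ x * x
      q^≈ = trans (*-congˡ (*-congˡ (^-homo-* q n n)))
        (solve 2 (λ q y → q :* (q :* (y :* y)) := (q :* y) :* (q :* y)) refl q (q ^ n))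

    -- Truncation: from the finite identity to (q)ₙ³

    -- The left side is the product of 1 - qʲ over a < j ≤ a + b, and each factor is 1 modulo qᵃ⁺¹.
    -- In an abstract ring, agreement up to a power of q is stated with an explicit multiple `w`.
    P-quotient : ∀ b a → ∃ λ w → P (b ℕ.+ a) * G a ≈ 1# + q ^ suc a * w
    P-quotient zero    a = 0# , trans (P*G≈1 a) (solve 1 (λ y → con 1 := con 1 :+ y :* con 0) refl (q ^ suc a))
    P-quotient (suc b) a with w , eq ← P-quotient b a =
      w - q ^ b * (1# + y * w) , (begin
      P (b ℕ.+ a) * (1# - q ^ suc (b ℕ.+ a)) * G a
        ≈⟨ *-congʳ (*-congˡ (+-congˡ (-‿cong (trans (reflexive (≡.cong (q ^_) (≡.sym (ℕ.+-suc b a)))) (^-homo-* q b (suc a)))))) ⟩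
      P (b ℕ.+ a) * (1# - q ^ b * y) * G a
        ≈⟨ solve 4 (λ p x y g → p :* (con 1 :- x :* y) :* g := p :* g :* (con 1 :- x :* y)) refl (P (b ℕ.+ a)) (q ^ b) y (G a) ⟩
      P (b ℕ.+ a) * G a * (1# - q ^ b * y)  ≈⟨ *-congʳ eq ⟩
      (1# + y * w) * (1# - q ^ b * y)
        ≈⟨ solve 3 (λ x y w → let o = con 1 in
             (o :+ y :* w) :* (o :- x :* y) := o :+ y :* (w :- x :* (o :+ y :* w))) refl (q ^ b) y w ⟩
      1# + y * (w - q ^ b * (1# + y * w))  ∎)
      where y = q ^ suc a

    -- The exponent k suffices: the error of `P-quotient` at n - k is a multiple of qⁿ⁻ᵏ⁺¹, and the
    -- factor qᵏ raises it to qⁿ⁺¹.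
    θ-divisible : ∀ k → ∃ λ w → θ k ≈ q ^ k * w
    θ-divisible zero    = 1# , sym (*-identityˡ 1#)
    θ-divisible (suc k) = - θ k , solve 2 (λ s y → :- (s :* y) := y :* :- s) refl (θ k) (q ^ suc k)

    private
      approximation-+ : ∀ k i → let n = k ℕ.+ i in
        ∃ λ w → P n * P (suc (n ℕ.+ n)) * t n k ≈ θ k + q ^ suc n * w
      approximation-+ k i
        with θ′ , θ≈ ← θ-divisible k
           | w₁ , eq₁ ← P-quotient k i
           | w₂ , eq₂ ← P-quotient i (suc (k ℕ.+ i ℕ.+ k))
        rewrite ℕ.+-suc i (k ℕ.+ i ℕ.+ k)
              | ℕ.+-comm i (k ℕ.+ i ℕ.+ k) | ℕ.+-assoc (k ℕ.+ i) k i
              | ≡.sym (ℕ.+-suc k i) | ℕ.m+n∸m≡n k (suc i) = W , (begin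
        P n * P₂ * (θ k * (G i * G (suc (n ℕ.+ k))))
          ≈⟨ solve 5 (λ p p₂ s g h → p :* p₂ :* (s :* (g :* h)) := s :* ((p :* g) :* (p₂ :* h))) refl
               (P n) P₂ (θ k) (G i) (G (suc (n ℕ.+ k))) ⟩
        θ k * ((P n * G i) * (P₂ * G (suc (n ℕ.+ k))))
          ≈⟨ *-congˡ (*-cong eq₁ eq₂) ⟩
        θ k * ((1# + q ^ suc i * w₁) * (1# + q ^ suc (suc (n ℕ.+ k)) * w₂))
          ≈⟨ substitute (q * y * w₁ * (1# + q * (q * V) * w₂)) θ≈
             (substitute (- (q * (θ′ * w₁ * (1# + q * (q * V) * w₂)))) (^-homo-* q k i)
             (substitute (θ k * q * q * w₂) (^-homo-* q n k)
             (solve 9 (λ q y z X V s θ′ w₁ w₂ →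
               let o = con 1
                   e = o :+ q :* (q :* V) :* w₂
                   k₁ = q :* y :* w₁ :* e
                   k₂ = :- (q :* (θ′ :* w₁ :* e))
                   k₃ = s :* q :* q :* w₂
               in
                  s :* ((o :+ q :* y :* w₁) :* e) :- k₁ :* s :- k₂ :* X :- k₃ :* V
               := s :+ q :* X :* (θ′ :* w₁ :* e :+ s :* (q :* z) :* w₂)
                    :- k₁ :* (z :* θ′) :- k₂ :* (z :* y) :- k₃ :* (X :* z))
               refl q y (q ^ k) (q ^ n) V (θ k) θ′ w₁ w₂))) ⟩
        θ k + q ^ suc n * W  ∎)
        where
        n = k ℕ.+ i
        P₂ = P (suc (n ℕ.+ n))
        y = q ^ i
        V = q ^ (n ℕ.+ k)
        W = θ′ * w₁ * (1# + q * (q * V) * w₂) + θ k * (q * q ^ k) * w₂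

    t-approximation : ∀ n k → ∃ λ w → P n * P (suc (n ℕ.+ n)) * t n k ≈ θ k + q ^ suc n * w
    t-approximation n k with k ℕ.≤? n
    ... | yes k≤n = ≡.subst (λ n → ∃ λ w → P n * P (suc (n ℕ.+ n)) * t n k ≈ θ k + q ^ suc n * w)
      (ℕ.m+[n∸m]≡n k≤n) (approximation-+ k (n ∸ k))
    -- Here `t n k` is 0 and all of `θ k` is error: being a multiple of qᵏ, it is one of qⁿ⁺¹.
    ... | no  k≰n with θ′ , θ≈ ← θ-divisible k = - (q ^ (k ∸ suc n) * θ′) , (begin
      P n * P (suc (n ℕ.+ n)) * t n k  ≈⟨ *-congˡ (t-vanishes {n} n<k) ⟩
      P n * P (suc (n ℕ.+ n)) * 0#     ≈⟨ zeroʳ _ ⟩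
      0#                               ≈⟨ solve 3 (λ x y w → con 0 := x :* y :* w :+ x :* :- (y :* w)) refl (q ^ suc n) (q ^ (k ∸ suc n)) θ′ ⟩
      q ^ suc n * q ^ (k ∸ suc n) * θ′ + q ^ suc n * - (q ^ (k ∸ suc n) * θ′)
        ≈⟨ +-congʳ (*-congʳ (^-homo-* q (suc n) (k ∸ suc n))) ⟨
      q ^ (suc n ℕ.+ (k ∸ suc n)) * θ′ + q ^ suc n * - (q ^ (k ∸ suc n) * θ′)
        ≡⟨ ≡.cong (λ j → q ^ j * θ′ + q ^ suc n * - (q ^ (k ∸ suc n) * θ′)) (ℕ.m+[n∸m]≡n n<k) ⟩
      q ^ k * θ′ + q ^ suc n * - (q ^ (k ∸ suc n) * θ′)
        ≈⟨ +-congʳ θ≈ ⟨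
      θ k + q ^ suc n * - (q ^ (k ∸ suc n) * θ′)  ∎)
      where n<k = ℕ.≰⇒> k≰n

    private
      Σ-approximation : ∀ {p y} {f g h : ℕ → Carrier} → (∀ k → ∃ λ w → p * g k ≈ h k + y * w) →
        ∀ m → ∃ λ w → p * Σ< m (λ k → f k * g k) ≈ Σ< m (λ k → f k * h k) + y * w
      Σ-approximation {p} {y} _ zero = 0# , solve 2 (λ p y → p :* con 0 := con 0 :+ y :* con 0) refl p y
      Σ-approximation {p} {y} {f} {g} {h} approx (suc m)
        with w , eq ← approx m | v , eqs ← Σ-approximation {p} {y} {f} {g} {h} approx m = v + f m * w , (begin
        p * (S + f m * g m)            ≈⟨ solve 4 (λ p s f g → p :* (s :+ f :* g) := p :* s :+ f :* (p :* g)) refl p S (f m) (g m) ⟩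
        p * S + f m * (p * g m)        ≈⟨ +-cong eqs (*-congˡ eq) ⟩
        (S′ + y * v) + f m * (h m + y * w)
          ≈⟨ solve 6 (λ s y v f h w → (s :+ y :* v) :+ f :* (h :+ y :* w) := (s :+ f :* h) :+ y :* (v :+ f :* w)) refl S′ y v (f m) (h m) w ⟩
        (S′ + f m * h m) + y * (v + f m * w) ∎)
        where
        S = Σ< m (λ k → f k * g k)
        S′ = Σ< m (λ k → f k * h k)

    -- One more factor `P n` on `finiteJacobi` completes the cube and also normalises every `t n k`
    -- to `θ k`.
    P³-approximation : ∀ n → ∃ λ w →
      P n ^ 3 ≈ Σ< (suc (suc n)) (λ k → odd k * θ k) + q ^ suc n * w
    P³-approximation n =
      map₂ (trans P³≈) (Σ-approximation {P n * P (suc (n ℕ.+ n))} {q ^ suc n} {odd} {t n} {θ} (t-approximation n) (suc (suc n)))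
      where
      P³≈ : P n ^ 3 ≈ P n * P (suc (n ℕ.+ n)) * jacobiSum (suc (suc n)) n
      P³≈ = begin
        P n ^ 3                                                ≈⟨ solve 1 (λ p → p :^ 3 := p :* (p :* p)) refl (P n) ⟩
        P n * (P n * P n)                                      ≈⟨ *-congˡ (finiteJacobi n (suc n) (ℕ.n<1+n n)) ⟨
        P n * (P (suc (n ℕ.+ n)) * jacobiSum (suc (suc n)) n)  ≈⟨ *-assoc _ _ _ ⟨
        P n * P (suc (n ℕ.+ n)) * jacobiSum (suc (suc n)) n    ∎

  odd-periodic : ∀ k → odd (5 ℕ.+ k) ≈ odd k
  odd-periodic k = solve 1 (λ x → let two = con 1 :+ con 1 in
    x :+ two :+ two :+ two :+ two :+ two := x) refl (odd k)

  odd-2 : odd 2 ≈ 0#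
  odd-2 = solve 0 (let two = con 1 :+ con 1 in con 1 :+ two :+ two := con 0) refl

open import Data.Nat.Base using (_+_; _*_)

-- Enumeration of plane partitions row by row

module Enumeration where
  open import Data.Nat.Properties
  open ≡ using (refl; sym; trans; cong; cong₂; subst)

  -- (b , c) encodes the row of b twos followed by c ones.
  Code : Set
  Code = ℕ × ℕ

  row : Code → List ℕ
  row (b , c) = replicate b 2 ++ replicate c 1

  _≼_ : Code → Code → Set
  (b′ , c′) ≼ (b , c) = b′ ≤ b × b′ + c′ ≤ b + c

  Nonzero : Code → Set
  Nonzero (b , c) = 0 < b + c

  length-row : ∀ p → length (row p) ≡ proj₁ p + proj₂ p
  length-row (b , c) = trans (List.length-++ (replicate b 2)) (cong₂ _+_ (List.length-replicate b) (List.length-replicate c))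

  sum-row : ∀ p → sum (row p) ≡ proj₁ p + (proj₁ p + proj₂ p)
  sum-row (zero  , zero)  = refl
  sum-row (zero  , suc c) = cong suc (sum-row (zero , c))
  sum-row (suc b , c)     = trans (cong (2 +_) (sum-row (b , c))) (cong suc (sym (+-suc b (b + c))))

  -- The length b + c and the sum b + (b + c) determine b and c.
  row-injective : ∀ {p p′} → row p ≡ row p′ → p ≡ p′
  row-injective {p@(b , c)} {p′@(b′ , c′)} eq = cong₂ _,_ b≡b′
    (+-cancelˡ-≡ b c c′ (trans lengths (cong (_+ c′) (sym b≡b′))))
    where
    lengths : b + c ≡ b′ + c′
    lengths = trans (sym (length-row p)) (trans (cong length eq) (length-row p′))
    b≡b′ : b ≡ b′
    b≡b′ = +-cancelʳ-≡ (b + c) b b′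
      (trans (trans (sym (sum-row p)) (trans (cong sum eq) (sum-row p′))) (cong (b′ +_) (sym lengths)))

  ≼⇒⊵ : ∀ p p′ → p′ ≼ p → row p ⊵ row p′
  ≼⇒⊵ _           (zero   , zero)   _             = []
  ≼⇒⊵ (zero  , suc c) (zero , suc c′) (_ , s≤s c′≤c) = s≤s z≤n ∷ ≼⇒⊵ (zero , c) (zero , c′) (z≤n , c′≤c)
  ≼⇒⊵ (suc b , c)     (zero , suc c′) (_ , s≤s c′≤)  = s≤s z≤n ∷ ≼⇒⊵ (b , c) (zero , c′) (z≤n , c′≤)
  ≼⇒⊵ (suc b , c) (suc b′ , c′) (s≤s b′≤b , s≤s ≤bc) = ≤-refl ∷ ≼⇒⊵ (b , c) (b′ , c′) (b′≤b , ≤bc)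

  ⊵⇒≼ : ∀ p p′ → row p ⊵ row p′ → p′ ≼ p
  ⊵⇒≼ _               (zero   , zero)   _             = z≤n , z≤n
  ⊵⇒≼ (zero  , suc c) (zero   , suc c′) (_ ∷ r) = z≤n , s≤s (proj₂ (⊵⇒≼ (zero , c) (zero , c′) r))
  ⊵⇒≼ (suc b , c)     (zero   , suc c′) (_ ∷ r) = z≤n , s≤s (proj₂ (⊵⇒≼ (b , c) (zero , c′) r))
  ⊵⇒≼ (zero  , suc c) (suc b′ , c′)     (s≤s () ∷ _)
  ⊵⇒≼ (suc b , c)     (suc b′ , c′)     (_ ∷ r) with b′≤b , ≤bc ← ⊵⇒≼ (b , c) (b′ , c′) r = s≤s b′≤b , s≤s ≤bc

  row-positive : ∀ p → All (0 <_) (row p)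
  row-positive (b , c) = All.++⁺ (All.replicate⁺ b (s≤s z≤n)) (All.replicate⁺ c (s≤s z≤n))

  row-≤2 : ∀ p → All (_≤ 2) (row p)
  row-≤2 (b , c) = All.++⁺ (All.replicate⁺ b ≤-refl) (All.replicate⁺ c (s≤s z≤n))

  row-decreasing : ∀ p → Linked _≥_ (row p)
  row-decreasing (zero        , zero)        = []
  row-decreasing (zero        , suc zero)    = [-]
  row-decreasing (zero        , suc (suc c)) = ≤-refl ∷ row-decreasing (zero , suc c)
  row-decreasing (suc zero    , zero)        = [-]
  row-decreasing (suc zero    , suc c)       = s≤s z≤n ∷ row-decreasing (zero , suc c)
  row-decreasing (suc (suc b) , c)           = ≤-refl ∷ row-decreasing (suc b , c)

  row-isRow : ∀ p → Nonzero p → IsRow (row p)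
  row-isRow p p≢0 = subst (0 <_) (sym (length-row p)) p≢0 , row-positive p , row-decreasing p

  row-surjective : ∀ {r} → All (0 <_) r → All (_≤ 2) r → Linked _≥_ r → ∃ λ p → row p ≡ r
  row-surjective [] _ _ = (0 , 0) , refl
  row-surjective {1 ∷ []} _ _ _ = (0 , 1) , refl
  row-surjective {2 ∷ []} _ _ _ = (1 , 0) , refl
  row-surjective {suc (suc (suc _)) ∷ _} _ (s≤s (s≤s ()) ∷ _) _
  row-surjective {1 ∷ s@(_ ∷ _)} (_ ∷ pos) (_ ∷ ≤2) (x≥ ∷ dec) with row-surjective pos ≤2 dec
  ... | (zero  , c) , eq   = (0 , suc c) , cong (1 ∷_) eq
  ... | (suc b , c) , refl with s≤s () ← x≥
  row-surjective {2 ∷ s@(_ ∷ _)} (_ ∷ pos) (_ ∷ ≤2) (x≥ ∷ dec) with row-surjective pos ≤2 dec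
  ... | (b , c) , eq = (suc b , c) , cong (2 ∷_) eq

  isRow⇒row : ∀ {r} → IsRow r → All (_≤ 2) r → ∃ λ p → Nonzero p × row p ≡ r
  isRow⇒row (0<length , pos , dec) ≤2 with p , refl ← row-surjective pos ≤2 dec =
    p , subst (0 <_) (length-row p) 0<length , refl

  -- exact b c lists the rows of length b + c with at most b twos, and below b c the nonempty
  -- rows that fit under (b , c).
  exact : ℕ → ℕ → List Code
  exact zero    c = (zero , c) ∷ []
  exact (suc b) c = (suc b , c) ∷ exact b (suc c)

  below : ℕ → ℕ → List Code
  below b       (suc c) = exact b (suc c) ++ below b c
  below zero    zero    = []
  below (suc b) zero    = exact (suc b) zero ++ below b zero

  ∈-exact⁻ : ∀ b c {p′} → p′ ∈ exact b c → proj₁ p′ ≤ b × proj₁ p′ + proj₂ p′ ≡ b + c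
  ∈-exact⁻ zero    c (here refl) = ≤-refl , refl
  ∈-exact⁻ (suc b) c (here refl) = ≤-refl , refl
  ∈-exact⁻ (suc b) c (there p′∈) with b′≤b , eq ← ∈-exact⁻ b (suc c) p′∈ = m≤n⇒m≤1+n b′≤b , trans eq (+-suc b c)

  ∈-exact⁺ : ∀ b c {p′} → proj₁ p′ ≤ b → proj₁ p′ + proj₂ p′ ≡ b + c → p′ ∈ exact b c
  ∈-exact⁺ zero    c z≤n refl = here refl
  ∈-exact⁺ (suc b) c {b′ , c′} b′≤ eq with b′ ≟ suc b
  ... | yes refl = here (cong (suc b ,_) (+-cancelˡ-≡ (suc b) c′ c eq))
  ... | no  b′≢  = there (∈-exact⁺ b (suc c) (≤-pred (≤∧≢⇒< b′≤ b′≢)) (trans eq (sym (+-suc b c))))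

  ∈-below⁻ : ∀ b c {p′} → p′ ∈ below b c → p′ ≼ (b , c) × Nonzero p′
  ∈-below⁻ b (suc c) p′∈ with ∈-++⁻ (exact b (suc c)) p′∈
  ... | inj₁ p′∈ with b′≤b , eq ← ∈-exact⁻ b (suc c) p′∈ =
    (b′≤b , ≤-reflexive eq) , subst (0 <_) (sym (trans eq (+-suc b c))) (s≤s z≤n)
  ... | inj₂ p′∈ with (b′≤b , ≤bc) , p′≢0 ← ∈-below⁻ b c p′∈ =
    (b′≤b , ≤-trans ≤bc (+-monoʳ-≤ b (n≤1+n c))) , p′≢0
  ∈-below⁻ (suc b) zero p′∈ with ∈-++⁻ (exact (suc b) zero) p′∈
  ... | inj₁ p′∈ with b′≤b , eq ← ∈-exact⁻ (suc b) zero p′∈ =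
    (b′≤b , ≤-reflexive eq) , subst (0 <_) (sym eq) (s≤s z≤n)
  ... | inj₂ p′∈ with (b′≤b , ≤bc) , p′≢0 ← ∈-below⁻ b zero p′∈ =
    (m≤n⇒m≤1+n b′≤b , m≤n⇒m≤1+n ≤bc) , p′≢0

  ∈-below⁺ : ∀ b c {p′} → p′ ≼ (b , c) → Nonzero p′ → p′ ∈ below b c
  ∈-below⁺ b (suc c) {b′ , c′} (b′≤b , ≤bc) p′≢0 with b′ + c′ ≟ b + suc c
  ... | yes eq = ∈-++⁺ˡ (∈-exact⁺ b (suc c) b′≤b eq)
  ... | no  ≢  = ∈-++⁺ʳ (exact b (suc c))
    (∈-below⁺ b c (b′≤b , ≤-pred (subst (b′ + c′ <_) (+-suc b c) (≤∧≢⇒< ≤bc ≢))) p′≢0)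
  ∈-below⁺ zero zero {zero , zero} _ ()
  ∈-below⁺ (suc b) zero {b′ , c′} (b′≤b , ≤bc) p′≢0 with b′ + c′ ≟ suc b + zero
  ... | yes eq = ∈-++⁺ˡ (∈-exact⁺ (suc b) zero b′≤b eq)
  -- With at most b cells there are at most b twos, so the length bound implies both conditions for
  -- `(b , 0)`.
  ... | no  ≢  = ∈-++⁺ʳ (exact (suc b) zero)
    (∈-below⁺ b zero (≤-trans (m≤m+n b′ c′) (subst (b′ + c′ ≤_) (+-identityʳ b) bound) , bound) p′≢0)
    where
    bound : b′ + c′ ≤ b + zero
    bound = ≤-pred (≤∧≢⇒< ≤bc ≢)

  exact-unique : ∀ b c → Unique (exact b c)
  exact-unique zero    c = [] ∷ []
  exact-unique (suc b) c =
    All.tabulate (λ { {b′ , _} p∈ refl → 1+n≰n (proj₁ (∈-exact⁻ b (suc c) p∈)) }) ∷ exact-unique b (suc c)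

  below-unique : ∀ b c → Unique (below b c)
  below-unique b (suc c) = Unique.++⁺ (exact-unique b (suc c)) (below-unique b c)
    λ (∈e , ∈b) → 1+n≰n (≤-trans (≤-reflexive (trans (sym (+-suc b c)) (sym (proj₂ (∈-exact⁻ b (suc c) ∈e))))) (proj₂ (proj₁ (∈-below⁻ b c ∈b))))
  below-unique zero    zero = []
  below-unique (suc b) zero = Unique.++⁺ (exact-unique (suc b) zero) (below-unique b zero)
    λ (∈e , ∈b) → 1+n≰n (≤-trans (≤-reflexive (sym (proj₂ (∈-exact⁻ (suc b) zero ∈e)))) (proj₂ (proj₁ (∈-below⁻ b zero ∈b))))

  -- chains k p lists the plane partitions with at most k rows that fit under row p.
  chains : ℕ → Code → List (List Code)
  chains zero    p = [] ∷ []
  chains (suc k) p = [] ∷ concatMap (λ p′ → map (p′ ∷_) (chains k p′)) (uncurry below p)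

  chains-unique : ∀ k p → Unique (chains k p)
  chains-unique zero    p = [] ∷ []
  chains-unique (suc k) p = All.tabulate nonempty ∷ Unique.concat⁺
    (All.map⁺ (All.tabulate λ {p′} _ → Unique.map⁺ List.∷-injectiveʳ (chains-unique k p′)))
    (AllPairs.map⁺ (AllPairs.map disjoint (uncurry below-unique p)))
    where
    f : Code → List (List Code)
    f p′ = map (p′ ∷_) (chains k p′)
    nonempty : ∀ {π} → π ∈ concatMap f (uncurry below p) → [] ≢ π
    nonempty π∈ refl with _ , _ , π∈′ ← find (∈-concatMap⁻ f {uncurry below p} π∈) with () ← proj₂ (proj₂ (∈-map⁻ (_ ∷_) π∈′))
    disjoint : ∀ {p₁ p₂} → p₁ ≢ p₂ → ∀ {π} → π ∈ f p₁ × π ∈ f p₂ → ⊥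
    disjoint p₁≢p₂ (∈₁ , ∈₂) with _ , _ , refl ← ∈-map⁻ (_ ∷_) ∈₁ | _ , _ , eq ← ∈-map⁻ (_ ∷_) ∈₂ =
      p₁≢p₂ (List.∷-injectiveˡ eq)

  chains-sound : ∀ k p {π} → π ∈ chains k p →
    All IsRow (map row π) × EntriesAtMost2 (map row π) × Linked _⊵_ (row p ∷ map row π)
  chains-sound zero    p (here refl) = [] , [] , [-]
  chains-sound (suc k) p (here refl) = [] , [] , [-]
  chains-sound (suc k) p (there π∈)
    with p′ , p′∈ , π∈′ ← find (∈-concatMap⁻ _ {uncurry below p} π∈)
    with π′ , π′∈ , refl ← ∈-map⁻ (p′ ∷_) π∈′
    with p′≼p , p′≢0 ← ∈-below⁻ _ _ p′∈
       | rows , ≤2 , linked ← chains-sound k p′ π′∈ =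
    row-isRow p′ p′≢0 ∷ rows , row-≤2 p′ ∷ ≤2 , ≼⇒⊵ p p′ p′≼p ∷ linked

  chains-complete : ∀ k p {π} → length π ≤ k → All IsRow π → EntriesAtMost2 π → Linked _⊵_ (row p ∷ π) →
    ∃ λ cs → cs ∈ chains k p × map row cs ≡ π
  chains-complete zero    p z≤n [] [] _ = [] , here refl , refl
  chains-complete (suc k) p _   [] [] _ = [] , here refl , refl
  chains-complete (suc k) p (s≤s len) (r ∷ rs) (r≤2 ∷ ≤2) (p⊵r ∷ linked)
    with p′ , p′≢0 , refl ← isRow⇒row r r≤2
    with cs , cs∈ , refl ← chains-complete k p′ len rs ≤2 linked =
    p′ ∷ cs , there (∈-concatMap⁺ _ (lose (∈-below⁺ _ _ (⊵⇒≼ p p′ p⊵r) p′≢0) (∈-map⁺ (p′ ∷_) cs∈))) , refl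

  weight : List Code → ℕ
  weight π = size (map row π)

  private
    length≤sum : ∀ {ms} → All (0 <_) ms → length ms ≤ sum ms
    length≤sum []         = z≤n
    length≤sum (0<m ∷ ms) = +-mono-≤ 0<m (length≤sum ms)

    length≤size : ∀ {π} → All IsRow π → length π ≤ size π
    length≤size []       = z≤n
    length≤size ((0<length , pos , _) ∷ rs) = +-mono-≤ (≤-trans 0<length (length≤sum pos)) (length≤size rs)

    -- A row of n twos imposes no constraint on a plane partition of n: its first row has b + c ≤ b
    -- + (b + c) ≤ n cells.
    row-bound : ∀ {n π} → IsPlanePartition₂ n π → Linked _⊵_ (row (n , 0) ∷ π)
    row-bound {π = []}    _ = [-]
    row-bound {n} {r ∷ π} ((r-row ∷ _ , linked) , r≤2 ∷ _ , refl)
      with (b , c) , _ , refl ← isRow⇒row r-row r≤2 = ≼⇒⊵ (n , 0) (b , c) (≤-trans (m≤m+n b c) b+c≤n , ≤-trans b+c≤n (m≤m+n n 0)) ∷ linked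
      where
      b+c≤n : b + c ≤ n
      b+c≤n = ≤-trans (m≤n+m (b + c) b) (≤-trans (≤-reflexive (sym (sum-row (b , c)))) (m≤m+n _ (size π)))

  -- Two duplicate-free lists with the same members are permutations of each other. The depth is
  -- `suc n` because `chains-series k` controls exponents below k.
  pl₂-chains : ∀ n → pl₂ n ≡ length (filter (λ π → weight π ≟ n) (chains (suc n) (n , 0)))
  pl₂-chains n = begin
    pl₂ n                           ≡⟨ ↭-length (∼bag⇒↭ (unique∧set⇒bag (planePartitions₂-unique n) unique (mk⇔ to from))) ⟩
    length (map (map row) chainsₙ)  ≡⟨ List.length-map (map row) chainsₙ ⟩
    length chainsₙ                  ∎
    where
    open ≡.≡-Reasoning
    P? = λ π → weight π ≟ n
    L = chains (suc n) (n , 0)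
    chainsₙ = filter P? L
    unique : Unique (map (map row) chainsₙ)
    unique = Unique.map⁺ (List.map-injective row-injective) (Unique.filter⁺ P? (chains-unique (suc n) (n , 0)))
    to : ∀ {π} → π ∈ planePartitions₂ n → π ∈ map (map row) chainsₙ
    to π∈ with pp@((rows , linked) , ≤2 , eq) ← Equivalence.to (∈-planePartitions₂ n) π∈
      with cs , cs∈ , refl ← chains-complete (suc n) (n , 0) (m≤n⇒m≤1+n (subst (_ ≤_) eq (length≤size rows))) rows ≤2 (row-bound pp) =
      ∈-map⁺ (map row) (∈-filter⁺ P? cs∈ eq)
    from : ∀ {π} → π ∈ map (map row) chainsₙ → π ∈ planePartitions₂ n
    from π∈ with cs , cs∈ , refl ← ∈-map⁻ (map row) π∈
      with cs∈L , eq ← ∈-filter⁻ P? {xs = L} cs∈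
      with rows , ≤2 , linked ← chains-sound (suc n) (n , 0) cs∈L =
      Equivalence.from (∈-planePartitions₂ n) ((rows , tail linked) , ≤2 , eq)

-- Generating functions of the enumeration

open Enumeration
open CommutativeRing ℤ/5 using (_≈_) renaming (refl to ≈-refl; sym to ≈-sym; trans to ≈-trans; +-cong to ≈-+-cong; *-cong to ≈-*-cong; setoid to ≈-setoid)
open PowerSeries ℤ/5
open CommutativeRing seriesRing using (0#; 1#; setoid) renaming (_+_ to _⊕_; _-_ to _⊖_; refl to ≋-refl; sym to ≋-sym; trans to ≋-trans)
private module S = CommutativeRing seriesRing

seriesRing-characteristic5 : HasCharacteristic5 seriesRing
seriesRing-characteristic5 = pointwise λ { zero → mod5 ≡.refl ; (suc _) → mod5 ≡.refl }

open Characteristic5 seriesRing seriesRing-characteristic5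

G : ℕ → Series
G zero    = 1#
G (suc a) = G a ⋆ geometric (suc a)

G-suc : ∀ a → G a ≋ (1# ⊖ q ^ suc a) ⋆ G (suc a)
G-suc a = geometric-inverse (G a) (geometric-unfold (suc a))

open QSeries q G ≋-refl G-suc

weightSeries : List (List Code) → Series
weightSeries []      = 0#
weightSeries (π ∷ L) = q ^ weight π ⊕ weightSeries L

weightSeries-++ : ∀ L L′ → weightSeries (L ++ L′) ≋ weightSeries L ⊕ weightSeries L′
weightSeries-++ []      L′ = ≋-sym (S.+-identityˡ (weightSeries L′))
weightSeries-++ (π ∷ L) L′ = ≋-trans (S.+-congˡ (weightSeries-++ L L′))
  (≋-sym (S.+-assoc (q ^ weight π) (weightSeries L) (weightSeries L′)))

weightSeries-∷ : ∀ b c L → weightSeries (map ((b , c) ∷_) L) ≋ q ^ (b + (b + c)) ⋆ weightSeries L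
weightSeries-∷ b c []      = ≋-sym (S.zeroʳ (q ^ (b + (b + c))))
weightSeries-∷ b c (π ∷ L) rewrite sum-row (b , c) = begin
  q ^ (w + weight π) ⊕ weightSeries (map ((b , c) ∷_) L)  ≈⟨ S.+-cong (^-homo-* q w (weight π)) (weightSeries-∷ b c L) ⟩
  q ^ w ⋆ q ^ weight π ⊕ q ^ w ⋆ weightSeries L           ≈⟨ S.distribˡ (q ^ w) (q ^ weight π) (weightSeries L) ⟨
  q ^ w ⋆ (q ^ weight π ⊕ weightSeries L)                 ∎
  where
  open import Relation.Binary.Reasoning.Setoid setoid
  w = b + (b + c)

q^-coefficient-≡ : ∀ m → (q ^ m) m ≈ 1
q^-coefficient-≡ zero    = ≈-refl
q^-coefficient-≡ (suc m) = ≈-trans (q-suc (q ^ m) m) (q^-coefficient-≡ m)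

q^-coefficient-≢ : ∀ m n → m ≢ n → (q ^ m) n ≈ 0
q^-coefficient-≢ zero    zero    m≢n = contradiction ≡.refl m≢n
q^-coefficient-≢ zero    (suc n) _   = ≈-refl
q^-coefficient-≢ (suc m) zero    _   = q-zero (q ^ m)
q^-coefficient-≢ (suc m) (suc n) m≢n = ≈-trans (q-suc (q ^ m) n) (q^-coefficient-≢ m n (λ m≡n → m≢n (≡.cong suc m≡n)))

weightSeries-coefficient : ∀ L n → length (filter (λ π → weight π ℕ.≟ n) L) ≈ weightSeries L n
weightSeries-coefficient []      n = ≈-refl
weightSeries-coefficient (π ∷ L) n = step (P? π)
  where
  open import Relation.Binary.Reasoning.Setoid ≈-setoid
  P? : (π : List Code) → Dec (weight π ≡ n)
  P? π = weight π ℕ.≟ n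
  step : Dec (weight π ≡ n) → length (filter P? (π ∷ L)) ≈ weightSeries (π ∷ L) n
  step (yes w≡n) = begin
    length (filter P? (π ∷ L))         ≡⟨ ≡.cong length (List.filter-accept P? {π} {L} w≡n) ⟩
    1 + length (filter P? L)           ≈⟨ ≈-+-cong (≡.subst (λ n → (q ^ weight π) n ≈ 1) w≡n (q^-coefficient-≡ (weight π)))
                                            (≈-sym (weightSeries-coefficient L n)) ⟨
    weightSeries (π ∷ L) n             ∎
  step (no w≢n) = begin
    length (filter P? (π ∷ L))         ≡⟨ ≡.cong length (List.filter-reject P? {π} {L} w≢n) ⟩
    0 + length (filter P? L)           ≈⟨ ≈-+-cong (q^-coefficient-≢ (weight π) n w≢n)
                                            (≈-sym (weightSeries-coefficient L n)) ⟨
    weightSeries (π ∷ L) n             ∎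

infix 4 _≈[_]_
_≈[_]_ : Series → ℕ → Series → Set
f ≈[ k ] g = ∀ n → n < k → f n ≈ g n

-- A factor qᵐ with m > 0 gains an order of accuracy; since a nonempty row has positive weight, each
-- further row allowed extends the agreement by one exponent.
q^-shift : ∀ {f g k} m → 0 < m → f ≈[ k ] g → q ^ m ⋆ f ≈[ suc k ] q ^ m ⋆ g
q^-shift {f} {g} {k} m 0<m f≈g n n<1+k with n ℕ.<? m
... | yes n<m = ≈-trans (q^-< m f n<m) (≈-sym (q^-< m g n<m))
... | no  n≮m = begin
  (q ^ m ⋆ f) n              ≡⟨ ≡.cong (q ^ m ⋆ f) n≡ ⟨
  (q ^ m ⋆ f) (m + (n ∸ m))  ≈⟨ q^-+ m f (n ∸ m) ⟩
  f (n ∸ m)                  ≈⟨ f≈g (n ∸ m) n∸m<k ⟩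
  g (n ∸ m)                  ≈⟨ q^-+ m g (n ∸ m) ⟨
  (q ^ m ⋆ g) (m + (n ∸ m))  ≡⟨ ≡.cong (q ^ m ⋆ g) n≡ ⟩
  (q ^ m ⋆ g) n              ∎
  where
  open import Relation.Binary.Reasoning.Setoid ≈-setoid
  m≤n = ℕ.≮⇒≥ n≮m
  n≡ = ℕ.m+[n∸m]≡n m≤n
  n∸m<k : n ∸ m < k
  n∸m<k = ℕ.<-≤-trans (ℕ.∸-monoʳ-< 0<m m≤n) (ℕ.≤-pred n<1+k)

module _ (k : ℕ) (ih : ∀ b c → weightSeries (chains k (b , c)) ≈[ k ] Φ b c) where
  private
    extend : Code → List (List Code)
    extend p = map (p ∷_) (chains k p)

    extend-series : ∀ b c → 0 < b + c → weightSeries (extend (b , c)) ≈[ suc k ] q ^ (b + (b + c)) ⋆ Φ b c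
    extend-series b c 0<b+c n n< = ≈-trans (coefficient (weightSeries-∷ b c (chains k (b , c))) n)
      (q^-shift (b + (b + c)) (ℕ.<-≤-trans 0<b+c (ℕ.m≤n+m (b + c) b)) (ih b c) n n<)

    exact-series : ∀ b c → 0 < b + c → weightSeries (concatMap extend (exact b c)) ≈[ suc k ] Ψ b c
    exact-series zero c 0<c n n< = begin
      weightSeries (extend (0 , c) ++ []) n  ≈⟨ coefficient (weightSeries-++ (extend (0 , c)) []) n ⟩
      weightSeries (extend (0 , c)) n + 0    ≡⟨ ℕ.+-identityʳ _ ⟩
      weightSeries (extend (0 , c)) n        ≈⟨ extend-series 0 c 0<c n n< ⟩
      (q ^ c ⋆ Φ 0 c) n                      ≈⟨ coefficient (Ψ-zero c) n ⟩
      Ψ 0 c n                                ∎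
      where open import Relation.Binary.Reasoning.Setoid ≈-setoid
    exact-series (suc b) c 0< n n< = begin
      weightSeries (extend (suc b , c) ++ concatMap extend (exact b (suc c))) n
        ≈⟨ coefficient (weightSeries-++ (extend (suc b , c)) _) n ⟩
      weightSeries (extend (suc b , c)) n + weightSeries (concatMap extend (exact b (suc c))) n
        ≈⟨ ≈-+-cong (extend-series (suc b) c 0< n n<)
             (exact-series b (suc c) (ℕ.<-≤-trans (s≤s z≤n) (ℕ.m≤n+m (suc c) b)) n n<) ⟩
      (q ^ (suc b + (suc b + c)) ⋆ Φ (suc b) c) n + Ψ b (suc c) n
        ≈⟨ ≈-+-cong (coefficient (S.*-congʳ (^-homo-* q (suc b) (suc b + c))) n) ≈-refl ⟩
      (q ^ suc b ⋆ q ^ (suc b + c) ⋆ Φ (suc b) c) n + Ψ b (suc c) n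
        ≈⟨ coefficient (Ψ-suc b c) n ⟩
      Ψ (suc b) c n  ∎
      where open import Relation.Binary.Reasoning.Setoid ≈-setoid

    -- The step shared by both recursive clauses of `below`, fed with `Φ-suc` or `Φ-suc-zero`; the
    -- summand `1#` stands for the empty plane partition.
    below-step : ∀ b c b′ c′ → 0 < b + c → Φ b c ≋ Φ b′ c′ ⊕ Ψ b c →
      1# ⊕ weightSeries (concatMap extend (below b′ c′)) ≈[ suc k ] Φ b′ c′ →
      1# ⊕ weightSeries (concatMap extend (exact b c ++ below b′ c′)) ≈[ suc k ] Φ b c
    below-step b c b′ c′ 0< Φ≈ ih′ n n< rewrite List.concatMap-++ extend (exact b c) (below b′ c′) = begin
      1# n + weightSeries (concatMap extend (exact b c) ++ concatMap extend (below b′ c′)) n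
        ≈⟨ ≈-+-cong ≈-refl (coefficient (weightSeries-++ (concatMap extend (exact b c)) _) n) ⟩
      1# n + (s₁ + s₂)    ≡⟨ ≡.cong (1# n +_) (ℕ.+-comm s₁ s₂) ⟩
      1# n + (s₂ + s₁)    ≡⟨ ℕ.+-assoc (1# n) s₂ s₁ ⟨
      (1# n + s₂) + s₁    ≈⟨ ≈-+-cong (ih′ n n<) (exact-series b c 0< n n<) ⟩
      Φ b′ c′ n + Ψ b c n  ≈⟨ coefficient Φ≈ n ⟨
      Φ b c n              ∎
      where
      open import Relation.Binary.Reasoning.Setoid ≈-setoid
      s₁ = weightSeries (concatMap extend (exact b c)) n
      s₂ = weightSeries (concatMap extend (below b′ c′)) n

    below-series : ∀ b c → 1# ⊕ weightSeries (concatMap extend (below b c)) ≈[ suc k ] Φ b c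
    below-series b       (suc c) = below-step b (suc c) b c (ℕ.<-≤-trans (s≤s z≤n) (ℕ.m≤n+m (suc c) b)) (Φ-suc b c) (below-series b c)
    below-series zero    zero    n _ = ≈-trans (coefficient (S.+-identityʳ 1#) n) (≈-sym (coefficient Φ-zero n))
    below-series (suc b) zero    = below-step (suc b) zero b zero (s≤s z≤n) (Φ-suc-zero b) (below-series b zero)

  chains-series-suc : ∀ b c → weightSeries (chains (suc k) (b , c)) ≈[ suc k ] Φ b c
  chains-series-suc = below-series

chains-series : ∀ k b c → weightSeries (chains k (b , c)) ≈[ k ] Φ b c
chains-series zero    b c n ()
chains-series (suc k) = chains-series-suc k (chains-series k)

-- Vanishing at exponents 2, 3, 4 modulo 5

triangular : ℕ → ℕ
triangular zero    = 0
triangular (suc k) = suc k + triangular k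

q^-vanishes : ∀ {f} m n → (∀ j → m + j ≡ n → f j ≈ 0) → (q ^ m ⋆ f) n ≈ 0
q^-vanishes {f} m n f≈0 with n ℕ.<? m
... | yes n<m = q^-< m f n<m
... | no  n≮m = begin
  (q ^ m ⋆ f) n              ≡⟨ ≡.cong (q ^ m ⋆ f) n≡ ⟨
  (q ^ m ⋆ f) (m + (n ∸ m))  ≈⟨ q^-+ m f (n ∸ m) ⟩
  f (n ∸ m)                  ≈⟨ f≈0 (n ∸ m) n≡ ⟩
  0                          ∎
  where
  open import Relation.Binary.Reasoning.Setoid ≈-setoid
  n≡ = ℕ.m+[n∸m]≡n (ℕ.≮⇒≥ n≮m)

θ-support : ∀ k n → n ≢ triangular k → θ k n ≈ 0
θ-support zero    zero    n≢ = contradiction ≡.refl n≢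
θ-support zero    (suc n) _  = ≈-refl
θ-support (suc k) n       n≢ = ≈-*-cong {4} ≈-refl (≈-trans (coefficient (S.*-comm (θ k) (q ^ suc k)) n)
  (q^-vanishes (suc k) n λ j eq → θ-support k j λ { ≡.refl → n≢ (≡.sym eq) }))

-- Multiplication by a constant series cannot enlarge the support of `θ k`.
odd-constant : ∀ k → odd k ≋ constant (odd k 0)
odd-constant k = pointwise λ { zero → ≈-refl ; (suc n) → higher k n }
  where
  higher : ∀ k n → odd k (suc n) ≈ 0
  higher zero    n = ≈-refl
  higher (suc k) n = ≈-+-cong (higher k n) ≈-refl

constant-⋆-support : ∀ {f x} g n → f ≋ constant x → g n ≈ 0 → (f ⋆ g) n ≈ 0
constant-⋆-support {f} {x} g n f≋ g≈0 = begin
  (f ⋆ g) n           ≈⟨ coefficient (S.*-congʳ f≋) n ⟩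
  (constant x ⋆ g) n  ≈⟨ constant-⋆ x g n ⟩
  x * g n             ≈⟨ ≈-*-cong {x} ≈-refl g≈0 ⟩
  x * 0               ≡⟨ ℕ.*-zeroʳ x ⟩
  0                   ∎
  where open import Relation.Binary.Reasoning.Setoid ≈-setoid

-- Both residues and coefficients have period 5 in k; only k ≡ 2 gives a triangular
-- number outside {0 , 1}, and then the coefficient 2k + 1 is divisible by 5.
triangular-odd : ∀ k → triangular k % 5 < 2 ⊎ odd k ≋ 0#
triangular-odd 0 = inj₁ (s≤s z≤n)
triangular-odd 1 = inj₁ (s≤s (s≤s z≤n))
triangular-odd 2 = inj₂ odd-2
triangular-odd 3 = inj₁ (s≤s (s≤s z≤n))
triangular-odd 4 = inj₁ (s≤s z≤n)
triangular-odd (suc (suc (suc (suc (suc k))))) with triangular-odd k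
... | inj₁ <2 = inj₁ (≡.subst (_< 2) (≡.sym (≡.trans (≡.cong (_% 5) (periodic k (triangular k)))
                        ([m+kn]%n≡m%n (triangular k) (3 + k) 5))) <2)
  where
  periodic : ∀ k t → 5 + k + (4 + k + (3 + k + (2 + k + (1 + k + t)))) ≡ t + (3 + k) * 5
  periodic = solve-∀
... | inj₂ ≋0 = inj₂ (≋-trans (odd-periodic k) ≋0)

-- The bound N reflects that `P³-approximation N` determines coefficients only up to exponent N.
Vanishes : ℕ → Series → Set
Vanishes N f = ∀ n → n ≤ N → 2 ≤ n % 5 → f n ≈ 0

vanishes-cong : ∀ {N f g} → f ≋ g → Vanishes N g → Vanishes N f
vanishes-cong f≋g g≈0 n n≤N 2≤ = ≈-trans (coefficient f≋g n) (g≈0 n n≤N 2≤)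

vanishes-+ : ∀ {N f g} → Vanishes N f → Vanishes N g → Vanishes N (f ⊕ g)
vanishes-+ f≈0 g≈0 n n≤N 2≤ = ≈-+-cong (f≈0 n n≤N 2≤) (g≈0 n n≤N 2≤)

odd*θ-vanishes : ∀ N k → Vanishes N (odd k ⋆ θ k)
odd*θ-vanishes N k n _ 2≤ = case (n ℕ.≟ triangular k) (triangular-odd k)
  where
  case : Dec (n ≡ triangular k) → triangular k % 5 < 2 ⊎ odd k ≋ 0# → (odd k ⋆ θ k) n ≈ 0
  case (no  n≢) _         = constant-⋆-support (θ k) n (odd-constant k) (θ-support k n n≢)
  case (yes n≡) (inj₁ <2) = contradiction (≡.subst (λ n → 2 ≤ n % 5) n≡ 2≤) (ℕ.<⇒≱ <2)
  case (yes _)  (inj₂ ≋0) = coefficient (≋-trans (S.*-congʳ ≋0) (S.zeroˡ (θ k))) n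

Σ-vanishes : ∀ {N f} → (∀ k → Vanishes N (f k)) → ∀ m → Vanishes N (Σ< m f)
Σ-vanishes f≈0 zero    _ _ _ = ≈-refl
Σ-vanishes f≈0 (suc m) = vanishes-+ (Σ-vanishes f≈0 m) (f≈0 m)

P³-vanishes : ∀ N → Vanishes N (P N ^ 3)
P³-vanishes N = vanishes-cong (proj₂ approximation)
  (vanishes-+ (Σ-vanishes (odd*θ-vanishes N) (suc (suc N))) λ n n≤N _ → q^-< (suc N) (proj₁ approximation) (s≤s n≤N))
  where approximation = P³-approximation N

-- The equation says h = f / (1 - q^(5(a+1))). A shift by a multiple of 5 keeps residues, so strong
-- induction on the exponent carries the vanishing from f to h.
vanishes-quotient : ∀ {N f h} a → h ≋ f ⊕ q ^ (suc a * 5) ⋆ h → Vanishes N f → Vanishes N h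
vanishes-quotient {N} {f} {h} a h≋ f≈0 = <-rec _ λ n rec n≤N 2≤ →
  ≈-trans (coefficient h≋ n) (≈-+-cong (f≈0 n n≤N 2≤) (q^-vanishes (suc a * 5) n λ { j ≡.refl →
    rec (ℕ.m<n+m j (s≤s z≤n)) (ℕ.≤-trans (ℕ.m≤n+m j (suc a * 5)) n≤N)
      (≡.subst (2 ≤_) (≡.trans (≡.cong (_% 5) (ℕ.+-comm (suc a * 5) j)) ([m+kn]%n≡m%n j (suc a) 5)) 2≤) }))

-- N and a are separate so that the cube stays fixed while the factors 1 - q⁵ⁱ are divided out one
-- at a time.
P³G⁵-vanishes : ∀ N a → Vanishes N (P N ^ 3 ⋆ G a ^ 5)
P³G⁵-vanishes N zero    = vanishes-cong P³≋ (P³-vanishes N)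
  where
  P³≋ : P N ^ 3 ⋆ 1# ^ 5 ≋ P N ^ 3
  P³≋ = solve 1 (λ p → p :* con 1 :^ 5 := p) ≋-refl (P N ^ 3)
P³G⁵-vanishes N (suc a) = vanishes-quotient a unfold (P³G⁵-vanishes N a)
  where
  unfold : P N ^ 3 ⋆ G (suc a) ^ 5 ≋ P N ^ 3 ⋆ G a ^ 5 ⊕ q ^ (suc a * 5) ⋆ (P N ^ 3 ⋆ G (suc a) ^ 5)
  unfold = substitute (P N ^ 3) (G⁵-suc a)
    (solve 4 (λ p g h y → p :* g :- p :* g := p :* h :+ y :* (p :* g) :- p :* (h :+ y :* g)) ≋-refl
      (P N ^ 3) (G (suc a) ^ 5) (G a ^ 5) (q ^ (suc a * 5)))

G²-vanishes : ∀ N → Vanishes N (G N ⋆ G N)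
G²-vanishes N = vanishes-cong (G²≈P³G⁵ N) (P³G⁵-vanishes N N)

-- The congruences

pl₂-Φ : ∀ n → pl₂ n ≈ Φ n 0 n
pl₂-Φ n = begin
  pl₂ n                                                              ≡⟨ pl₂-chains n ⟩
  length (filter (λ π → weight π ℕ.≟ n) (chains (suc n) (n , 0)))    ≈⟨ weightSeries-coefficient (chains (suc n) (n , 0)) n ⟩
  weightSeries (chains (suc n) (n , 0)) n                            ≈⟨ chains-series (suc n) n 0 n (ℕ.n<1+n n) ⟩
  Φ n 0 n                                                            ∎
  where open import Relation.Binary.Reasoning.Setoid ≈-setoid

-- The coefficient of (1 - q) H at n + 1 is that of H at n + 1 minus that at n, so both residues
-- have to be at least 2; this selects n + 1 ≡ 3, 4.
5∣pl₂ : ∀ n → 2 ≤ n % 5 → 2 ≤ suc n % 5 → 5 ∣ pl₂ (suc n)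
5∣pl₂ n 2≤n 2≤1+n = m%n≡0⇒n∣m (pl₂ (suc n)) 5 (remainders (begin
  pl₂ (suc n)                                ≈⟨ pl₂-Φ (suc n) ⟩
  Φ (suc n) 0 (suc n)                        ≈⟨ coefficient Φ≋ (suc n) ⟩
  H (suc n) + 4 * (q ⋆ H) (suc n) + (y ⋆ ((q ⊖ 1#) ⋆ H)) (suc n)
    ≈⟨ ≈-+-cong (≈-+-cong (vanishing (suc n) (ℕ.n≤1+n (suc n)) 2≤1+n)
         (≈-*-cong {4} ≈-refl (≈-trans (q-suc H n) (vanishing n (ℕ.m≤n+m n 2) 2≤n))))
         (q^-< (2 + n) ((q ⊖ 1#) ⋆ H) (ℕ.n<1+n (suc n))) ⟩
  0                                          ∎))
  where
  open import Relation.Binary.Reasoning.Setoid ≈-setoid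
  y H : Series
  y = q ^ (2 + n)
  H = G (2 + n) ⋆ G (2 + n)
  vanishing : Vanishes (2 + n) H
  vanishing = G²-vanishes (2 + n)
  -- The factor 1 - y, with y = qⁿ⁺², changes coefficients only from exponent n + 2 on, so it is
  -- split off as a separate summand.
  Φ≋ : Φ (suc n) 0 ≋ H ⊖ q ⋆ H ⊕ y ⋆ ((q ⊖ 1#) ⋆ H)
  Φ≋ = ≋-trans (Φ-square (suc n)) (solve 3 (λ q y h → let o = con 1 in
    (o :- q) :* ((o :- y) :* h) := h :- q :* h :+ y :* ((q :- o) :* h)) ≋-refl q y H)

theorem4 : (n : ℕ) → 5 ∣ pl₂ (5 * n + 3) × 5 ∣ pl₂ (5 * n + 4)
theorem4 n = case 2 (s≤s (s≤s z≤n)) (s≤s (s≤s z≤n)) , case 3 (s≤s (s≤s z≤n)) (s≤s (s≤s z≤n))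
  where
  residue : ∀ r → (5 * n + r) % 5 ≡ r % 5
  residue r = ≡.trans (≡.cong (_% 5) (≡.trans (ℕ.+-comm (5 * n) r) (≡.cong (r +_) (ℕ.*-comm 5 n))))
    ([m+kn]%n≡m%n r n 5)
  case : ∀ r → 2 ≤ r % 5 → 2 ≤ suc r % 5 → 5 ∣ pl₂ (5 * n + suc r)
  case r 2≤r 2≤1+r = ≡.subst (λ m → 5 ∣ pl₂ m) (≡.sym (ℕ.+-suc (5 * n) r))
    (5∣pl₂ (5 * n + r) (≡.subst (2 ≤_) (≡.sym (residue r)) 2≤r)
      (≡.subst (2 ≤_) (≡.sym (≡.trans (≡.cong (_% 5) (≡.sym (ℕ.+-suc (5 * n) r))) (residue (suc r)))) 2≤1+r))
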